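{- Let $\mathcal{K}$ be a nonempty class of nontrivial BL-chains and let $\mathcal{V}=\mathsf{V}(\mathcal{K})$. Let $t(x)$ be a term in one variable in the language $\{\cdot,\to,\bot,\top\}$. The following are equivalent: (i) $t(x)$ is a conucleus on $\mathcal{V}$; (ii) $\mathcal{V}\vDash t(x)\approx\bot$, or $\mathcal{V}\vDash t(x)\approx t_0(\neg\neg x)\cdot t_1(\neg\neg x\to x)$ for some terms $t_0(x)$ and $t_1(x)$ in the language $\{\cdot,\to,\top\}$ such that $t_0(x)$ is a conucleus on $$\mathcal{V}_0:=\mathsf{V}\Big(\Big\{\mathbf{A}_0:\Big(\bigoplus_{i\in I}\mathbf{A}_i\Big)^+\in\mathcal{K}\Big\}\Big)$$ (where $0$ denotes the least element of $I$) and $t_1(x)$ is a conucleus on $$\mathcal{V}_1:=\mathsf{V}\Big(\Big\{\mathbf{A}_j:\Big(\bigoplus_{i\in I}\mathbf{A}_i\Big)^+\in\mathcal{K},\ j\in I\setminus\{0\}\Big\}\cup\{\mathbf{S}_0\}\Big).$$ The same equivalence holds with "conucleus" replaced by "multiplicative conucleus" throughout.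
   Context: A hoop is an algebra $\langle A,\cdot,\to,\top\rangle$ such that $\langle A,\cdot,\top\rangle$ is a commutative monoid and $x\to x=\top$, $x\cdot(x\to y)=y\cdot(y\to x)$, $x\to(y\to z)=(x\cdot y)\to z$; it is partially ordered by $x\le y$ iff $x\to y=\top$. A bounded hoop is an algebra $\langle A,\cdot,\to,\bot,\top\rangle$ whose $\{\cdot,\to,\top\}$-reduct is a hoop with least element $\bot$; $\neg a:=a\to\bot$. For a hoop $\mathbf{B}$ with least element, $\mathbf{B}^+$ is the bounded hoop obtained by adding that least element as the constant $\bot$. A Wajsberg hoop is a hoop satisfying $(x\to y)\to y\approx(y\to x)\to x$. A BL-algebra is a bounded hoop satisfying $((x\to y)\to z)\to(((y\to x)\to z)\to z)\approx\top$; a BL-chain is a totally ordered BL-algebra (equivalently, a totally ordered bounded hoop). $\mathbf{S}_0$ is the trivial (one-element) hoop. $\mathsf{V}(\cdot)$ denotes the generated variety; $\mathcal{V}_0,\mathcal{V}_1$ are varieties of (unbounded-language) hoops. Ordinal sum: for a total order $\langle I,\le\rangle$ and hoops $\mathbf{A}_i$ with $A_i\cap A_j=\{\top\}$ for $i\ne j$, $\bigoplus_{i\in I}\mathbf{A}_i$ has universe $\bigcup_i A_i$; on each $A_i$ the operations are those of $\mathbf{A}_i$; if $x\in A_i\setminus\{\top\}$ and $y\in A_j$ with $i<j$, then $x\cdot y=y\cdot x=x$ and $x\to y=\top$; if $y\in A_i$, $x\in A_j$, $i<j$, then $x\to y=y$. Known fact: every nontrivial BL-chain is of the form $(\bigoplus_{i\in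 I}\mathbf{A}_i)^+$ where $I$ is a total order with least element $0$, the $\mathbf{A}_i$ are nontrivial totally ordered Wajsberg hoops and $\mathbf{A}_0$ has a least element; the notation $(\bigoplus_{i\in I}\mathbf{A}_i)^+\in\mathcal{K}$ always refers to this decomposition. A conucleus on a (bounded) hoop $\mathbf{A}$ is an interior operator $\delta$ ($\delta(a)\le a$, $\delta$ monotone, $\delta\delta=\delta$) with $\delta(a)\cdot\delta(b)\le\delta(a\cdot b)$ and $\delta(a)\cdot\delta(\top)=\delta(a)$. A multiplicative conucleus is an interior operator with $\delta(a\cdot b)=\delta(a)\cdot\delta(b)$. A term $t(x)$ is a (multiplicative) conucleus on a variety if $t^{\mathbf{A}}$ is one on $\mathbf{A}$ for every member $\mathbf{A}$ of the variety. -}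

module Defs where

open import Algebra.Core using (Op₁; Op₂)
open import Algebra.Bundles using (CommutativeMonoid)
import Algebra.Construct.Terminal as Terminal
open import Algebra.Definitions using (Congruent₂)
open import Algebra.Structures using (IsCommutativeMonoid)
open import Data.Nat.Base using (ℕ)
open import Data.Product.Base using (∃; ∃₂; _×_)
open import Data.Unit.Base using (tt) renaming (⊤ to Unit)
open import Level using (Level; _⊔_; 0ℓ) renaming (suc to lsuc)
open import Relation.Binary.Bundles using (TotalOrder)
open import Relation.Binary.Core using (Rel)
open import Relation.Binary.Definitions using (Total)
import Relation.Binary.Construct.NonStrictToStrict as NonStrictToStrict
open import Relation.Nullary.Negation.Core using (¬_)
open import Relation.Unary using (Pred; _⊆_; _∈_)

private
  variable
    ℓ k : Level
    X : Set

------------------------------------------------------------------------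
-- Hoops, bounded hoops, BL-chains

record IsHoop {A : Set ℓ} (_≈_ : Rel A ℓ) (_∙_ _⇒_ : Op₂ A) (⊤ : A) : Set ℓ where
  field
    isCommutativeMonoid : IsCommutativeMonoid _≈_ _∙_ ⊤
    ⇒-cong              : Congruent₂ _≈_ _⇒_
    ⇒-refl              : ∀ x → (x ⇒ x) ≈ ⊤
    divisibility        : ∀ x y → (x ∙ (x ⇒ y)) ≈ (y ∙ (y ⇒ x))
    currying            : ∀ x y z → (x ⇒ (y ⇒ z)) ≈ ((x ∙ y) ⇒ z)

  open IsCommutativeMonoid isCommutativeMonoid public

record Hoop (ℓ : Level) : Set (lsuc ℓ) where
  infix  4 _≈_ _≤_
  infixr 6 _⇒_
  infixl 7 _∙_
  field
    Carrier : Set ℓ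
    _≈_     : Rel Carrier ℓ
    _∙_     : Op₂ Carrier
    _⇒_     : Op₂ Carrier
    ⊤       : Carrier
    isHoop  : IsHoop _≈_ _∙_ _⇒_ ⊤

  open IsHoop isHoop public

  _≤_ : Rel Carrier ℓ
  x ≤ y = (x ⇒ y) ≈ ⊤

module _ (A : Hoop ℓ) where
  open Hoop A

  Nontrivial : Set ℓ
  Nontrivial = ∃₂ λ x y → ¬ (x ≈ y)

  IsChain : Set ℓ
  IsChain = Total _≤_

  HasLeast : Set ℓ
  HasLeast = ∃ λ m → ∀ x → m ≤ x

  IsWajsberg : Set ℓ
  IsWajsberg = ∀ x y → ((x ⇒ y) ⇒ y) ≈ ((y ⇒ x) ⇒ x)

S₀ : Hoop ℓ
S₀ = record
  { Carrier = M.Carrier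
  ; _≈_     = M._≈_
  ; _∙_     = M._∙_
  ; _⇒_     = M._∙_
  ; ⊤       = M.ε
  ; isHoop  = record { isCommutativeMonoid = M.isCommutativeMonoid }
  }
  where module M = CommutativeMonoid Terminal.commutativeMonoid

record BoundedHoop (ℓ : Level) : Set (lsuc ℓ) where
  field
    hoop : Hoop ℓ

  open Hoop hoop public

  field
    ⊥       : Carrier
    ⊥-least : ∀ x → ⊥ ≤ x

record IsBLChain (A : BoundedHoop ℓ) : Set ℓ where
  open BoundedHoop A
  field
    prelinear : ∀ x y z → (((x ⇒ y) ⇒ z) ⇒ (((y ⇒ x) ⇒ z) ⇒ z)) ≈ ⊤
    total     : IsChain hoop

------------------------------------------------------------------------
-- Ordinal sums

-- B is, up to isomorphism, the ordinal sum of the A i.  The union of the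
-- universes is expressed by injections ι i into B that are jointly surjective
-- and overlap only in ⊤.  The index order carries a setoid equality, so the
-- family has to respect it: equal indices name the same subset of B.

record IsOrdinalSum (I : TotalOrder ℓ ℓ ℓ) (A : TotalOrder.Carrier I → Hoop ℓ)
                    (B : Hoop ℓ) : Set ℓ where
  private
    module I = TotalOrder I
    module A i = Hoop (A i)
  open NonStrictToStrict I._≈_ I._≤_ using (_<_)
  open Hoop B
  field
    ι          : ∀ i → A.Carrier i → Carrier
    ι-cong     : ∀ i {x y} → A._≈_ i x y → ι i x ≈ ι i y
    ι-inj      : ∀ i {x y} → ι i x ≈ ι i y → A._≈_ i x y
    ι-resp     : ∀ {i j} → i I.≈ j → ∀ x → ∃ λ y → ι i x ≈ ι j y
    ι-surj     : ∀ b → ∃₂ λ i x → ι i x ≈ b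
    ι-disjoint : ∀ {i j} → ¬ (i I.≈ j) → ∀ x y → ι i x ≈ ι j y → ι i x ≈ ⊤

    ι-⊤ : ∀ i → ι i (A.⊤ i) ≈ ⊤
    ι-∙ : ∀ i x y → ι i (A._∙_ i x y) ≈ ι i x ∙ ι i y
    ι-⇒ : ∀ i x y → ι i (A._⇒_ i x y) ≈ (ι i x ⇒ ι i y)

    <-∙ˡ : ∀ {i j} → i < j → ∀ x y → ¬ (ι i x ≈ ⊤) → ι i x ∙ ι j y ≈ ι i x
    <-∙ʳ : ∀ {i j} → i < j → ∀ x y → ¬ (ι i x ≈ ⊤) → ι j y ∙ ι i x ≈ ι i x
    <-⇒  : ∀ {i j} → i < j → ∀ x y → ¬ (ι i x ≈ ⊤) → (ι i x ⇒ ι j y) ≈ ⊤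
    >-⇒  : ∀ {i j} → i < j → ∀ x y → (ι j x ⇒ ι i y) ≈ ι i y

-- C = (⨁ A i)⁺ with nontrivial totally ordered Wajsberg components.  Since
-- (_)⁺ only names the least element, which ⊥ of C already is, it suffices that
-- the ⊥-free reduct of C is the ordinal sum.

record Decomposition (C : BoundedHoop ℓ) : Set (lsuc ℓ) where
  field
    index : TotalOrder ℓ ℓ ℓ

  module I = TotalOrder index

  field
    0#           : I.Carrier
    0#-least     : ∀ i → 0# I.≤ i
    component    : I.Carrier → Hoop ℓ
    nontrivial   : ∀ i → Nontrivial (component i)
    total        : ∀ i → IsChain (component i)
    wajsberg     : ∀ i → IsWajsberg (component i)
    least        : HasLeast (component 0#)
    isOrdinalSum : IsOrdinalSum index component (BoundedHoop.hoop C)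

data FirstComponents (K : Pred (BoundedHoop ℓ) k) : Pred (Hoop ℓ) (lsuc ℓ ⊔ k) where
  first : ∀ {C} → C ∈ K → (D : Decomposition C) →
          FirstComponents K (Decomposition.component D (Decomposition.0# D))

data UpperComponents (K : Pred (BoundedHoop ℓ) k) : Pred (Hoop ℓ) (lsuc ℓ ⊔ k) where
  upper   : ∀ {C} → C ∈ K → (D : Decomposition C) →
            ∀ j → ¬ (Decomposition.I._≈_ D j (Decomposition.0# D)) →
            UpperComponents K (Decomposition.component D j)
  trivial : UpperComponents K S₀

------------------------------------------------------------------------
-- Terms

infixr 6 _⇒ᵗ_
infixl 7 _∙ᵗ_
infix  8 ¬ᵗ_
infix  9 _⟨_⟩

data HoopTerm (X : Set) : Set where
  var       : X → HoopTerm X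
  _∙ᵗ_ _⇒ᵗ_ : HoopTerm X → HoopTerm X → HoopTerm X
  ⊤ᵗ        : HoopTerm X

data BoundedTerm (X : Set) : Set where
  var       : X → BoundedTerm X
  _∙ᵗ_ _⇒ᵗ_ : BoundedTerm X → BoundedTerm X → BoundedTerm X
  ⊤ᵗ ⊥ᵗ     : BoundedTerm X

¬ᵗ_ : BoundedTerm X → BoundedTerm X
¬ᵗ s = s ⇒ᵗ ⊥ᵗ

𝕩 : BoundedTerm Unit
𝕩 = var tt

_⟨_⟩ : HoopTerm Unit → BoundedTerm X → BoundedTerm X
var _    ⟨ s ⟩ = s
(p ∙ᵗ q) ⟨ s ⟩ = p ⟨ s ⟩ ∙ᵗ q ⟨ s ⟩
(p ⇒ᵗ q) ⟨ s ⟩ = p ⟨ s ⟩ ⇒ᵗ q ⟨ s ⟩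
⊤ᵗ       ⟨ s ⟩ = ⊤ᵗ

module _ (A : Hoop ℓ) where
  open Hoop A

  evalʰ : HoopTerm X → (X → Carrier) → Carrier
  evalʰ (var v)  ρ = ρ v
  evalʰ (p ∙ᵗ q) ρ = evalʰ p ρ ∙ evalʰ q ρ
  evalʰ (p ⇒ᵗ q) ρ = evalʰ p ρ ⇒ evalʰ q ρ
  evalʰ ⊤ᵗ       ρ = ⊤

  Satisfiesʰ : HoopTerm X → HoopTerm X → Set ℓ
  Satisfiesʰ p q = ∀ ρ → evalʰ p ρ ≈ evalʰ q ρ

module _ (A : BoundedHoop ℓ) where
  open BoundedHoop A

  evalᵇ : BoundedTerm X → (X → Carrier) → Carrier
  evalᵇ (var v)  ρ = ρ v
  evalᵇ (p ∙ᵗ q) ρ = evalᵇ p ρ ∙ evalᵇ q ρ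
  evalᵇ (p ⇒ᵗ q) ρ = evalᵇ p ρ ⇒ evalᵇ q ρ
  evalᵇ ⊤ᵗ       ρ = ⊤
  evalᵇ ⊥ᵗ       ρ = ⊥

  Satisfiesᵇ : BoundedTerm X → BoundedTerm X → Set ℓ
  Satisfiesᵇ p q = ∀ ρ → evalᵇ p ρ ≈ evalᵇ q ρ

------------------------------------------------------------------------
-- Varieties

-- A variety is the class of models of a set of identities in countably many
-- variables; the variety generated by K is the least variety containing K.
-- Hoops and bounded hoops are themselves varieties, so it is harmless to take
-- only (bounded) hoops as ambient algebras.

module Equational {a ℓ} {Alg : Set a} {Term : Set}
                  (Satisfies : Alg → Term → Term → Set ℓ) where

  Mod : Rel Term 0ℓ → Pred Alg ℓ
  Mod E A = ∀ {p q} → E p q → Satisfies A p q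

  Generated : Pred Alg k → Pred Alg (lsuc 0ℓ ⊔ a ⊔ ℓ ⊔ k)
  Generated K A = ∀ (E : Rel Term 0ℓ) → K ⊆ Mod E → A ∈ Mod E

𝕍ʰ : Pred (Hoop ℓ) k → Pred (Hoop ℓ) (lsuc ℓ ⊔ k)
𝕍ʰ = Equational.Generated {Term = HoopTerm ℕ} (λ A → Satisfiesʰ A)

𝕍ᵇ : Pred (BoundedHoop ℓ) k → Pred (BoundedHoop ℓ) (lsuc ℓ ⊔ k)
𝕍ᵇ = Equational.Generated {Term = BoundedTerm ℕ} (λ A → Satisfiesᵇ A)

infix 3 _⊨_≈_

_⊨_≈_ : Pred (BoundedHoop ℓ) k → BoundedTerm X → BoundedTerm X → Set (lsuc ℓ ⊔ k)
𝒱 ⊨ p ≈ q = ∀ {A} → A ∈ 𝒱 → Satisfiesᵇ A p q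

------------------------------------------------------------------------
-- Conuclei

module _ (A : Hoop ℓ) (δ : Op₁ (Hoop.Carrier A)) where
  open Hoop A

  record IsInterior : Set ℓ where
    field
      contractive : ∀ a → δ a ≤ a
      monotone    : ∀ {a b} → a ≤ b → δ a ≤ δ b
      idempotent  : ∀ a → δ (δ a) ≈ δ a

  record IsConucleus : Set ℓ where
    field
      isInterior        : IsInterior
      submultiplicative : ∀ a b → δ a ∙ δ b ≤ δ (a ∙ b)
      unital            : ∀ a → δ a ∙ δ ⊤ ≈ δ a

  record IsMultiplicativeConucleus : Set ℓ where
    field
      isInterior     : IsInterior
      multiplicative : ∀ a b → δ (a ∙ b) ≈ δ a ∙ δ b

ConucleusNotion : (ℓ : Level) → Set (lsuc ℓ)
ConucleusNotion ℓ = (A : Hoop ℓ) → Op₁ (Hoop.Carrier A) → Set ℓ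

Holdsʰ : ConucleusNotion ℓ → HoopTerm Unit → Pred (Hoop ℓ) k → Set (lsuc ℓ ⊔ k)
Holdsʰ P t 𝒱 = ∀ {A} → A ∈ 𝒱 → P A (λ a → evalʰ A t (λ _ → a))

Holdsᵇ : ConucleusNotion ℓ → BoundedTerm Unit → Pred (BoundedHoop ℓ) k → Set (lsuc ℓ ⊔ k)
Holdsᵇ P t 𝒱 = ∀ {A} → A ∈ 𝒱 → P (BoundedHoop.hoop A) (λ a → evalᵇ A t (λ _ → a))

{-# OPTIONS --safe #-}
module Submission where

-- In a BL-chain with Wajsberg components A i, the element ¬¬x is x or ⊤
-- according to whether x lies in A 0 or in a higher component, so the term
-- t₀(¬¬x)·t₁(¬¬x → x) acts as t₀ on A 0 and as t₁ on every other A i.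
-- Conversely, ⊥ can be eliminated from any unary term t: on a bounded Wajsberg
-- hoop t agrees with s or ¬s for some ⊥-free s, and on the elements x with
-- ¬x = ⊥ it agrees with some ⊥-free s or with ⊥.  In the bad cases t(⊤) = ⊥, so
-- a monotone t is constantly ⊥.  Both notions of conucleus are given by
-- identities, hence pass between 𝒦 and its variety and to components, and an
-- operator acting on each component as a conucleus is one on the ordinal sum.
-- The components of a chain are, with ⊤ added to each, the classes of the weak
-- order x ≪ y :⇔ y → x = x ≠ ⊤.

open import Defs
open import Algebra.Core using (Op₁)
open import Algebra.Definitions using (Congruent₁)
open import Axiom.ExcludedMiddle using (ExcludedMiddle)
open import Data.Maybe.Base using (Maybe; just; nothing)
open import Data.Nat.Base using (ℕ; zero; suc)
open import Data.Product.Base using (∃; ∃₂; _×_; _,_; proj₁; proj₂)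
open import Data.Sum.Base using (_⊎_; inj₁; inj₂)
open import Data.Unit.Base using () renaming (⊤ to Unit)
open import Function.Base using (case_of_)
open import Function.Bundles using (_⇔_; mk⇔; Equivalence)
open import Level using (Level; 0ℓ) renaming (suc to lsuc)
open import Relation.Binary.Bundles using (Poset; TotalOrder)
open import Relation.Binary.Core using (Rel)
import Relation.Binary.Construct.Interior.Symmetric as SymInterior
open SymInterior using (SymInterior; _,_)
import Relation.Binary.Construct.NonStrictToStrict as NonStrictToStrict
import Relation.Binary.Construct.On as On
open import Relation.Binary.PropositionalEquality.Core as ≡ using (_≡_; cong; cong₂; subst₂)
import Relation.Binary.Reasoning.PartialOrder as ≤-Reasoning
open import Relation.Nullary using (¬_; yes; no; contradiction)
open import Relation.Unary using (Pred; _⊆_; _∈_)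

private
  variable
    ℓ k : Level
    X : Set

-- Hoops

module HoopProperties (A : Hoop ℓ) where
  open Hoop A
  open import Relation.Binary.Reasoning.Setoid setoid

  ⇒-congˡ : ∀ {x y z} → y ≈ z → x ⇒ y ≈ x ⇒ z
  ⇒-congˡ = ⇒-cong refl

  ⇒-congʳ : ∀ {x y z} → y ≈ z → y ⇒ x ≈ z ⇒ x
  ⇒-congʳ eq = ⇒-cong eq refl

  exchange : ∀ x y z → x ⇒ y ⇒ z ≈ y ⇒ x ⇒ z
  exchange x y z = begin
    x ⇒ y ⇒ z ≈⟨ currying x y z ⟩
    x ∙ y ⇒ z ≈⟨ ⇒-congʳ (comm x y) ⟩
    y ∙ x ⇒ z ≈⟨ currying y x z ⟨
    y ⇒ x ⇒ z ∎

  private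
    ⊤⇒x≈x∙[x⇒⊤] : ∀ x → ⊤ ⇒ x ≈ x ∙ (x ⇒ ⊤)
    ⊤⇒x≈x∙[x⇒⊤] x = trans (sym (identityˡ _)) (divisibility ⊤ x)

  -- Divisibility gives `q` = x·p and currying gives ⊤ → p = p. As x → q = ⊤, divisibility also
  -- turns `x` into q·(q → x), which reduces to x·(⊤ → p) = q.
  ⇒-identityˡ : ∀ x → ⊤ ⇒ x ≈ x
  ⇒-identityˡ x = sym (begin
    x                           ≈⟨ identityʳ x ⟨
    x ∙ ⊤                       ≈⟨ ∙-congˡ x⇒q≈⊤ ⟨
    x ∙ (x ⇒ q)                 ≈⟨ divisibility x q ⟩
    q ∙ (q ⇒ x)                 ≈⟨ ∙-cong (⊤⇒x≈x∙[x⇒⊤] x) q⇒x≈p⇒⊤ ⟩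
    x ∙ p ∙ (p ⇒ ⊤)             ≈⟨ assoc _ _ _ ⟩
    x ∙ (p ∙ (p ⇒ ⊤))           ≈⟨ ∙-congˡ (⊤⇒x≈x∙[x⇒⊤] p) ⟨
    x ∙ (⊤ ⇒ p)                 ≈⟨ ∙-congˡ (currying ⊤ x ⊤) ⟩
    x ∙ (⊤ ∙ x ⇒ ⊤)             ≈⟨ ∙-congˡ (⇒-congʳ (identityˡ x)) ⟩
    x ∙ p                       ≈⟨ ⊤⇒x≈x∙[x⇒⊤] x ⟨
    q                           ∎)
    where
    p = x ⇒ ⊤
    q = ⊤ ⇒ x

    x⇒q≈⊤ : x ⇒ q ≈ ⊤
    x⇒q≈⊤ = trans (currying x ⊤ x) (trans (⇒-congʳ (identityʳ x)) (⇒-refl x))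

    q⇒x≈p⇒⊤ : q ⇒ x ≈ p ⇒ ⊤
    q⇒x≈p⇒⊤ = begin
      q ⇒ x     ≈⟨ ⇒-congʳ (trans (⊤⇒x≈x∙[x⇒⊤] x) (comm x p)) ⟩
      p ∙ x ⇒ x ≈⟨ currying p x x ⟨
      p ⇒ x ⇒ x ≈⟨ ⇒-congˡ (⇒-refl x) ⟩
      p ⇒ ⊤     ∎

  -- Rewriting `x` as ⊤ → x = (x → ⊤)·x and currying leaves an instance of y → y.
  ⇒-zeroʳ : ∀ x → x ⇒ ⊤ ≈ ⊤
  ⇒-zeroʳ x = begin
    x ⇒ ⊤               ≈⟨ ⇒-congʳ (⇒-identityˡ x) ⟨
    (⊤ ⇒ x) ⇒ ⊤         ≈⟨ ⇒-congʳ (trans (⊤⇒x≈x∙[x⇒⊤] x) (comm _ _)) ⟩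
    (x ⇒ ⊤) ∙ x ⇒ ⊤     ≈⟨ currying _ _ _ ⟨
    (x ⇒ ⊤) ⇒ (x ⇒ ⊤)   ≈⟨ ⇒-refl _ ⟩
    ⊤                   ∎

  x≤⊤ : ∀ x → x ≤ ⊤
  x≤⊤ = ⇒-zeroʳ

  ≤-refl : ∀ {x} → x ≤ x
  ≤-refl = ⇒-refl _

  ≤-reflexive : ∀ {x y} → x ≈ y → x ≤ y
  ≤-reflexive x≈y = trans (⇒-congʳ x≈y) ≤-refl

  meet : ∀ {x y} → x ≤ y → y ∙ (y ⇒ x) ≈ x
  meet {x} {y} x≤y = begin
    y ∙ (y ⇒ x) ≈⟨ divisibility y x ⟩
    x ∙ (x ⇒ y) ≈⟨ ∙-congˡ x≤y ⟩
    x ∙ ⊤       ≈⟨ identityʳ x ⟩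
    x           ∎

  ≤-antisym : ∀ {x y} → x ≤ y → y ≤ x → x ≈ y
  ≤-antisym x≤y y≤x =
    trans (sym (meet x≤y)) (trans (∙-congˡ y≤x) (identityʳ _))

  ≤-trans : ∀ {x y z} → x ≤ y → y ≤ z → x ≤ z
  ≤-trans {x} {y} {z} x≤y y≤z = begin
    x ⇒ z             ≈⟨ ⇒-congʳ (trans (comm _ _) (meet x≤y)) ⟨
    (y ⇒ x) ∙ y ⇒ z   ≈⟨ currying _ _ _ ⟨
    (y ⇒ x) ⇒ y ⇒ z   ≈⟨ ⇒-congˡ y≤z ⟩
    (y ⇒ x) ⇒ ⊤       ≈⟨ x≤⊤ _ ⟩
    ⊤                 ∎

  ≤-poset : Poset ℓ ℓ ℓ
  ≤-poset = record
    { isPartialOrder = record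
      { isPreorder = record
        { isEquivalence = isEquivalence
        ; reflexive     = ≤-reflexive
        ; trans         = ≤-trans
        }
      ; antisym = ≤-antisym
      }
    }

  ⊤-maximum : ∀ {x} → ⊤ ≤ x → x ≈ ⊤
  ⊤-maximum ⊤≤x = ≤-antisym (x≤⊤ _) ⊤≤x

  residuate : ∀ {x y z} → x ∙ y ≤ z → x ≤ y ⇒ z
  residuate = trans (currying _ _ _)

  unresiduate : ∀ {x y z} → x ≤ y ⇒ z → x ∙ y ≤ z
  unresiduate = trans (sym (currying _ _ _))

  x∙y≤y : ∀ x y → x ∙ y ≤ y
  x∙y≤y x y = unresiduate (≤-trans (x≤⊤ x) (≤-reflexive (sym (⇒-refl y))))

  x∙y≤x : ∀ x y → x ∙ y ≤ x
  x∙y≤x x y = ≤-trans (≤-reflexive (comm x y)) (x∙y≤y y x)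

  y≤x⇒y : ∀ x y → y ≤ x ⇒ y
  y≤x⇒y x y = residuate (x∙y≤x y x)

  [x⇒y]∙x≤y : ∀ x y → (x ⇒ y) ∙ x ≤ y
  [x⇒y]∙x≤y x y = unresiduate ≤-refl

  x≤[x⇒y]⇒y : ∀ x y → x ≤ (x ⇒ y) ⇒ y
  x≤[x⇒y]⇒y x y =
    residuate (≤-trans (≤-reflexive (comm _ _)) ([x⇒y]∙x≤y x y))

  ∙-monoʳ-≤ : ∀ x {y z} → y ≤ z → x ∙ y ≤ x ∙ z
  ∙-monoʳ-≤ x {y} {z} y≤z = ≤-trans (≤-reflexive (comm _ _))
    (unresiduate (≤-trans y≤z (residuate (≤-reflexive (comm _ _)))))

  ⇒-monoʳ-≤ : ∀ x {y z} → y ≤ z → x ⇒ y ≤ x ⇒ z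
  ⇒-monoʳ-≤ x y≤z = residuate (≤-trans ([x⇒y]∙x≤y x _) y≤z)

  ⇒-antiˡ-≤ : ∀ {x y} z → x ≤ y → y ⇒ z ≤ x ⇒ z
  ⇒-antiˡ-≤ z x≤y = residuate (≤-trans (∙-monoʳ-≤ _ x≤y) ([x⇒y]∙x≤y _ z))

  -- Residuation into `y` forms an antitone Galois connection with itself.
  triple-⇒ : ∀ x y → ((x ⇒ y) ⇒ y) ⇒ y ≈ x ⇒ y
  triple-⇒ x y = ≤-antisym (⇒-antiˡ-≤ y (x≤[x⇒y]⇒y x y)) (x≤[x⇒y]⇒y (x ⇒ y) y)

-- Subhoops.

module _ (A : Hoop ℓ) where
  open Hoop A

  record IsSubuniverse (P : Pred Carrier ℓ) : Set ℓ where
    field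
      ⊤-closed : P ⊤
      ∙-closed : ∀ {x y} → P x → P y → P (x ∙ y)
      ⇒-closed : ∀ {x y} → P x → P y → P (x ⇒ y)

  subhoop : {P : Pred Carrier ℓ} → IsSubuniverse P → Hoop ℓ
  subhoop {P} sub = record
    { Carrier = ∃ P
    ; _≈_     = λ x y → proj₁ x ≈ proj₁ y
    ; _∙_     = λ x y → proj₁ x ∙ proj₁ y , ∙-closed (proj₂ x) (proj₂ y)
    ; _⇒_     = λ x y → (proj₁ x ⇒ proj₁ y) , ⇒-closed (proj₂ x) (proj₂ y)
    ; ⊤       = ⊤ , ⊤-closed
    ; isHoop  = record
      { isCommutativeMonoid = record
        { isMonoid = record
          { isSemigroup = record
            { isMagma = record
              { isEquivalence = On.isEquivalence proj₁ isEquivalence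
              ; ∙-cong        = ∙-cong
              }
            ; assoc = λ _ _ _ → assoc _ _ _
            }
          ; identity = (λ _ → identityˡ _) , (λ _ → identityʳ _)
          }
        ; comm = λ _ _ → comm _ _
        }
      ; ⇒-cong       = ⇒-cong
      ; ⇒-refl       = λ _ → ⇒-refl _
      ; divisibility = λ _ _ → divisibility _ _
      ; currying     = λ _ _ _ → currying _ _ _
      }
    }
    where
    open IsSubuniverse sub

-- Decomposition of chains

module ChainProperties (em : ExcludedMiddle ℓ) (A : Hoop ℓ) (total : IsChain A) where
  open Hoop A
  open HoopProperties A
  open import Relation.Binary.Reasoning.Setoid setoid

  ⇒-fixed⇒∙-absorbs : ∀ {d x} → x ≤ d → d ⇒ x ≈ x → d ∙ x ≈ x
  ⇒-fixed⇒∙-absorbs x≤d d⇒x≈x = trans (∙-congˡ (sym d⇒x≈x)) (meet x≤d)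

  -- Since d → y ≤ d → x = x, divisibility writes d → y as x·(x → (d → y)). The second factor is d·x
  -- → y, in which `x` absorbs `d`.
  ⇒-fixed-down : ∀ {d x y} → y ≤ x → x ≤ d → d ⇒ x ≈ x → d ⇒ y ≈ y
  ⇒-fixed-down {d} {x} {y} y≤x x≤d d⇒x≈x = begin
    d ⇒ y             ≈⟨ meet (≤-trans (⇒-monoʳ-≤ d y≤x) (≤-reflexive d⇒x≈x)) ⟨
    x ∙ (x ⇒ d ⇒ y)   ≈⟨ ∙-congˡ (trans (exchange x d y) (currying d x y)) ⟩
    x ∙ (d ∙ x ⇒ y)   ≈⟨ ∙-congˡ (⇒-congʳ (⇒-fixed⇒∙-absorbs x≤d d⇒x≈x)) ⟩
    x ∙ (x ⇒ y)       ≈⟨ meet y≤x ⟩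
    y                 ∎

  -- The gap between `y` and `y′` is measured by `d`, which satisfies d → u = u because d·y′ = y.
  -- Comparing `d` with `u` and then with `y′` forces y′ = y, except in a case where y′ = ⊤; there u
  -- ≤ x, against y → x ≠ x.
  ⇒-involutive : ∀ {x y} → x ≤ y → ¬ (y ⇒ x ≈ x) → (y ⇒ x) ⇒ x ≈ y
  ⇒-involutive {x} {y} x≤y y⇒x≉x = case total d u of λ where
      (inj₁ d≤u) → u≈⊤⇒y′≈y (trans (sym d⇒u≈u) d≤u)
      (inj₂ u≤d) → case total y′ d of λ where
        (inj₁ y′≤d) → y′≈y (⇒-fixed-down y≤y′ y′≤d (d⇒y′≈y′ u≤d))
        (inj₂ d≤y′) → contradiction
          (≤-antisym (trans (sym (d⇒y′≈y′ u≤d)) d≤y′) (y≤x⇒y y x))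
          y⇒x≉x
    where
    u  = y ⇒ x
    y′ = u ⇒ x
    d  = y′ ⇒ y

    y≤y′ : y ≤ y′
    y≤y′ = x≤[x⇒y]⇒y y x

    d⇒u≈u : d ⇒ u ≈ u
    d⇒u≈u = begin
      d ⇒ u           ≈⟨ ⇒-congˡ (triple-⇒ y x) ⟨
      d ⇒ (y′ ⇒ x)    ≈⟨ currying d y′ x ⟩
      d ∙ y′ ⇒ x      ≈⟨ ⇒-congʳ (trans (comm d y′) (meet y≤y′)) ⟩
      u               ∎

    d⇒y′≈y′ : u ≤ d → d ⇒ y′ ≈ y′
    d⇒y′≈y′ u≤d = begin
      d ⇒ y′      ≈⟨ currying d u x ⟩
      d ∙ u ⇒ x   ≈⟨ ⇒-congʳ (⇒-fixed⇒∙-absorbs u≤d d⇒u≈u) ⟩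
      y′          ∎

    y′≈y : d ⇒ y ≈ y → y′ ≈ y
    y′≈y d⇒y≈y =
      ≤-antisym (≤-trans (x≤[x⇒y]⇒y y′ y) (≤-reflexive d⇒y≈y)) y≤y′

    u≈⊤⇒y′≈y : u ≈ ⊤ → y′ ≈ y
    u≈⊤⇒y′≈y u≈⊤ = begin
      u ⇒ x   ≈⟨ ⇒-congʳ u≈⊤ ⟩
      ⊤ ⇒ x   ≈⟨ ⇒-identityˡ x ⟩
      x       ≈⟨ ≤-antisym x≤y u≈⊤ ⟩
      y       ∎

  -- The weak order whose classes are the components.

  infix 4 _≪_ _≲_ _∼_

  -- `x ≪ y` expresses that `x` lies in an earlier summand than `y`, with ⊤ counted above all other
  -- elements. `_∼_` is then membership in the same summand.
  _≪_ _≲_ _∼_ : Rel Carrier ℓ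
  x ≪ y = y ⇒ x ≈ x × ¬ (x ≈ ⊤)
  x ≲ y = ¬ (y ≪ x)
  _∼_   = SymInterior _≲_

  ≪⇒≤ : ∀ {x y} → x ≪ y → x ≤ y
  ≪⇒≤ {x} {y} (y⇒x≈x , x≉⊤) with total x y
  ... | inj₁ x≤y = x≤y
  ... | inj₂ y≤x = contradiction (trans (sym y⇒x≈x) y≤x) x≉⊤

  ≤⇒≲ : ∀ {x y} → x ≤ y → x ≲ y
  ≤⇒≲ x≤y (x⇒y≈y , y≉⊤) = y≉⊤ (trans (sym x⇒y≈y) x≤y)

  ≪-⊤ : ∀ {x y} → ¬ (x ≈ ⊤) → y ≈ ⊤ → x ≪ y
  ≪-⊤ x≉⊤ y≈⊤ = trans (⇒-congʳ y≈⊤) (⇒-identityˡ _) , x≉⊤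

  ≪-∙ : ∀ {x y} → x ≪ y → x ∙ y ≈ x
  ≪-∙ x≪y = trans (comm _ _) (⇒-fixed⇒∙-absorbs (≪⇒≤ x≪y) (proj₁ x≪y))

  -- Cotransitivity, which makes `_≪_` a strict weak order away from ⊤. If x ≤ y ≤ z and y → x ≠ x,
  -- then `y` and z → y have the same residual into `x`, and `⇒-involutive` recovers each of them
  -- from it.
  ≪-compare : ∀ {x z} y → ¬ (y ≈ ⊤) → x ≪ z → x ≪ y ⊎ y ≪ z
  ≪-compare {x} {z} y y≉⊤ x≪z@(z⇒x≈x , x≉⊤) with total y x | total y z
  ... | inj₁ y≤x | _        = inj₂ (⇒-fixed-down y≤x (≪⇒≤ x≪z) z⇒x≈x , y≉⊤)
  ... | inj₂ x≤y | inj₂ z≤y =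
    inj₁ (≤-antisym (≤-trans (⇒-antiˡ-≤ x z≤y) (≤-reflexive z⇒x≈x)) (y≤x⇒y y x) , x≉⊤)
  ... | inj₂ x≤y | inj₁ y≤z with em {y ⇒ x ≈ x}
  ...   | yes y⇒x≈x = inj₁ (y⇒x≈x , x≉⊤)
  ...   | no  y⇒x≉x = inj₂ (v≈y , y≉⊤)
    where
    v = z ⇒ y

    v⇒x≈y⇒x : v ⇒ x ≈ y ⇒ x
    v⇒x≈y⇒x = begin
      v ⇒ x         ≈⟨ ⇒-congˡ z⇒x≈x ⟨
      v ⇒ (z ⇒ x)   ≈⟨ exchange v z x ⟩
      z ⇒ (v ⇒ x)   ≈⟨ currying z v x ⟩
      z ∙ v ⇒ x     ≈⟨ ⇒-congʳ (meet y≤z) ⟩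
      y ⇒ x         ∎

    v≈y : v ≈ y
    v≈y = begin
      v             ≈⟨ ⇒-involutive (≤-trans x≤y (y≤x⇒y z y))
                                    (λ v⇒x≈x → y⇒x≉x (trans (sym v⇒x≈y⇒x) v⇒x≈x)) ⟨
      (v ⇒ x) ⇒ x   ≈⟨ ⇒-congʳ v⇒x≈y⇒x ⟩
      (y ⇒ x) ⇒ x   ≈⟨ ⇒-involutive x≤y y⇒x≉x ⟩
      y             ∎

  ≲-trans : ∀ {x y z} → ¬ (y ≈ ⊤) → x ≲ y → y ≲ z → x ≲ z
  ≲-trans {y = y} y≉⊤ x≲y y≲z z≪x with ≪-compare y y≉⊤ z≪x
  ... | inj₁ z≪y = y≲z z≪y
  ... | inj₂ y≪x = x≲y y≪x

  ∼-refl : ∀ {x} → x ∼ x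
  ∼-refl = ≤⇒≲ ≤-refl , ≤⇒≲ ≤-refl

  ∼-sym : ∀ {x y} → x ∼ y → y ∼ x
  ∼-sym = SymInterior.symmetric

  ∼-trans : ∀ {x y z} → ¬ (y ≈ ⊤) → x ∼ y → y ∼ z → x ∼ z
  ∼-trans y≉⊤ (x≲y , y≲x) (y≲z , z≲y) =
    ≲-trans y≉⊤ x≲y y≲z , ≲-trans y≉⊤ z≲y y≲x

  ≈⇒∼ : ∀ {x y} → x ≈ y → x ∼ y
  ≈⇒∼ x≈y = ≤⇒≲ (≤-reflexive x≈y) , ≤⇒≲ (≤-reflexive (sym x≈y))

  ∼⇒≉⊤ : ∀ {x y} → ¬ (x ≈ ⊤) → x ∼ y → ¬ (y ≈ ⊤)
  ∼⇒≉⊤ x≉⊤ x∼y y≈⊤ = SymInterior.rhs≤lhs x∼y (≪-⊤ x≉⊤ y≈⊤)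

  -- Otherwise x → x·y = x·y, and y ≤ x → x·y yields x·y = y; then x → y = y, contradicting x ∼ y.
  ∼-∙ : ∀ {x y} → ¬ (y ≈ ⊤) → x ∼ y → x ∼ x ∙ y
  ∼-∙ {x} {y} y≉⊤ (x≲y , _) = x≲x∙y , ≤⇒≲ (x∙y≤x x y)
    where
    x≲x∙y : x ≲ x ∙ y
    x≲x∙y (x⇒x∙y≈x∙y , _) = x≲y (trans (⇒-congˡ (sym x∙y≈y)) (trans x⇒x∙y≈x∙y x∙y≈y) , y≉⊤)
      where
      x∙y≈y : x ∙ y ≈ y
      x∙y≈y = ≤-antisym (x∙y≤y x y)
        (≤-trans (residuate (≤-reflexive (comm y x))) (≤-reflexive x⇒x∙y≈x∙y))

  -- `⇒-involutive` gives (x → y) → y = x. If `y` were in an earlier class than x → y, this value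
  -- would be `y`, so x → y = ⊤.
  ∼-⇒ : ∀ {x y} → ¬ (y ≈ ⊤) → ¬ (x ⇒ y ≈ ⊤) → y ≤ x → y ∼ x → y ∼ x ⇒ y
  ∼-⇒ {x} {y} y≉⊤ x⇒y≉⊤ y≤x (y≲x , x≲y) = ≤⇒≲ (y≤x⇒y x y) , u≲y
    where
    u≲y : x ⇒ y ≲ y
    u≲y (u⇒y≈y , _) = x⇒y≉⊤ (≤-reflexive (trans (sym x′≈x) u⇒y≈y))
      where
      x′≈x : (x ⇒ y) ⇒ y ≈ x
      x′≈x = ⇒-involutive y≤x (λ x⇒y≈y → x≲y (x⇒y≈y , y≉⊤))

  -- The index order and the components.

  Index : Set ℓ
  Index = ∃ λ x → ¬ (x ≈ ⊤)

  -- Each element other than ⊤ names its own class. A summand thus has many names, identified by the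
  -- setoid equality `_∼_` instead of a quotient.
  indexOrder : TotalOrder ℓ ℓ ℓ
  indexOrder = record
    { Carrier      = Index
    ; _≤_          = λ i j → proj₁ i ≲ proj₁ j
    ; isTotalOrder = record
      { isPartialOrder = SymInterior.isPartialOrder
          (λ {i} → ≤⇒≲ {proj₁ i} ≤-refl)
          (λ {i} {j} {k} → ≲-trans {proj₁ i} {z = proj₁ k} (proj₂ j))
      ; total = λ i j → case total (proj₁ i) (proj₁ j) of λ where
          (inj₁ i≤j) → inj₁ (≤⇒≲ i≤j)
          (inj₂ j≤i) → inj₂ (≤⇒≲ j≤i)
      }
    }

  Component : Index → Pred Carrier ℓ
  Component (i , _) x = x ≈ ⊤ ⊎ i ∼ x

  component-resp : ∀ i {x y} → x ≈ y → Component i x → Component i y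
  component-resp i x≈y (inj₁ x≈⊤) = inj₁ (trans (sym x≈y) x≈⊤)
  component-resp (i , i≉⊤) x≈y (inj₂ i∼x) =
    inj₂ (∼-trans (∼⇒≉⊤ i≉⊤ i∼x) i∼x (≈⇒∼ x≈y))

  component-∼ : ∀ i {x y} → ¬ (x ≈ ⊤) → ¬ (y ≈ ⊤) →
                Component i x → Component i y → x ∼ y
  component-∼ i x≉⊤ y≉⊤ (inj₁ x≈⊤) _ = contradiction x≈⊤ x≉⊤
  component-∼ i x≉⊤ y≉⊤ (inj₂ _) (inj₁ y≈⊤) = contradiction y≈⊤ y≉⊤
  component-∼ (i , i≉⊤) x≉⊤ y≉⊤ (inj₂ i∼x) (inj₂ i∼y) = ∼-trans i≉⊤ (∼-sym i∼x) i∼y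

  component-isSubuniverse : ∀ i → IsSubuniverse A (Component i)
  component-isSubuniverse i@(_ , i≉⊤) = record
    { ⊤-closed = inj₁ refl
    ; ∙-closed = ∙-closed
    ; ⇒-closed = ⇒-closed
    }
    where
    ∙-closed : ∀ {x y} → Component i x → Component i y → Component i (x ∙ y)
    ∙-closed (inj₁ x≈⊤) y∈ =
      component-resp i (sym (trans (∙-congʳ x≈⊤) (identityˡ _))) y∈
    ∙-closed x∈ (inj₁ y≈⊤) =
      component-resp i (sym (trans (∙-congˡ y≈⊤) (identityʳ _))) x∈
    ∙-closed x∈@(inj₂ i∼x) y∈@(inj₂ i∼y) = inj₂ (∼-trans x≉⊤ i∼x
      (∼-∙ y≉⊤ (component-∼ i x≉⊤ y≉⊤ x∈ y∈)))
      where
      x≉⊤ = ∼⇒≉⊤ i≉⊤ i∼x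
      y≉⊤ = ∼⇒≉⊤ i≉⊤ i∼y

    ⇒-closed : ∀ {x y} → Component i x → Component i y → Component i (x ⇒ y)
    ⇒-closed (inj₁ x≈⊤) y∈ =
      component-resp i (sym (trans (⇒-congʳ x≈⊤) (⇒-identityˡ _))) y∈
    ⇒-closed _ (inj₁ y≈⊤) = inj₁ (trans (⇒-congˡ y≈⊤) (x≤⊤ _))
    ⇒-closed {x} {y} x∈@(inj₂ i∼x) y∈@(inj₂ i∼y) with em {x ⇒ y ≈ ⊤} | total x y
    ... | yes x⇒y≈⊤ | _        = inj₁ x⇒y≈⊤
    ... | no  x⇒y≉⊤ | inj₁ x≤y = contradiction x≤y x⇒y≉⊤
    ... | no  x⇒y≉⊤ | inj₂ y≤x = inj₂ (∼-trans y≉⊤ i∼y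
      (∼-⇒ y≉⊤ x⇒y≉⊤ y≤x (component-∼ i y≉⊤ x≉⊤ y∈ x∈)))
      where
      x≉⊤ = ∼⇒≉⊤ i≉⊤ i∼x
      y≉⊤ = ∼⇒≉⊤ i≉⊤ i∼y

  componentHoop : Index → Hoop ℓ
  componentHoop i = subhoop A (component-isSubuniverse i)

  -- For y ≤ x the law amounts to (x → y) → y = x. `⇒-involutive` provides this unless x → y = y,
  -- which for elements other than ⊤ would put `y` in an earlier component than `x`.
  component-wajsberg : ∀ i → IsWajsberg (componentHoop i)
  component-wajsberg i (x , x∈) (y , y∈) = case total x y of λ where
      (inj₁ x≤y) → sym (wajsberg-≥ y∈ x∈ x≤y)
      (inj₂ y≤x) → wajsberg-≥ x∈ y∈ y≤x
    where
    wajsberg-≥ : ∀ {x y} → Component i x → Component i y → y ≤ x →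
                 (x ⇒ y) ⇒ y ≈ (y ⇒ x) ⇒ x
    wajsberg-≥ {x} {y} x∈ y∈ y≤x = trans [x⇒y]⇒y≈x (sym (trans (⇒-congʳ y≤x) (⇒-identityˡ x)))
      where
      [x⇒y]⇒y≈x : (x ⇒ y) ⇒ y ≈ x
      [x⇒y]⇒y≈x with em {x ⇒ y ≈ y} | em {x ≈ ⊤} | em {y ≈ ⊤}
      ... | no x⇒y≉y  | _       | _       = ⇒-involutive y≤x x⇒y≉y
      ... | yes x⇒y≈y | yes x≈⊤ | _       =
        trans (⇒-congʳ x⇒y≈y) (trans (⇒-refl y) (sym x≈⊤))
      ... | yes x⇒y≈y | no x≉⊤  | yes y≈⊤ =
        contradiction (⊤-maximum (≤-trans (≤-reflexive (sym y≈⊤)) y≤x)) x≉⊤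
      ... | yes x⇒y≈y | no x≉⊤  | no y≉⊤  =
        contradiction (x⇒y≈y , y≉⊤) (SymInterior.lhs≤rhs (component-∼ i x≉⊤ y≉⊤ x∈ y∈))

  private
    module I = TotalOrder indexOrder
  open NonStrictToStrict I._≈_ I._≤_ using (_<_)

  -- By excluded middle i < j means i ≪ j on representatives; two uses of `≪-compare` move this
  -- first to `x` and then to `y`.
  <⇒≪ : ∀ {i j x y} → i < j → Component i x → Component j y → ¬ (x ≈ ⊤) → x ≪ y
  <⇒≪ _ (inj₁ x≈⊤) _ x≉⊤ = contradiction x≈⊤ x≉⊤
  <⇒≪ _ (inj₂ _) (inj₁ y≈⊤) x≉⊤ = ≪-⊤ x≉⊤ y≈⊤
  <⇒≪ {i , _} {j , j≉⊤} {x} {y} (i≲j , i≁j) (inj₂ i∼x) (inj₂ j∼y) x≉⊤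
    with em {i ≪ j}
  ... | no  i≪̸j = contradiction (i≲j , i≪̸j) i≁j
  ... | yes i≪j with ≪-compare x x≉⊤ i≪j
  ...   | inj₁ i≪x = contradiction i≪x (SymInterior.rhs≤lhs i∼x)
  ...   | inj₂ x≪j with ≪-compare y (∼⇒≉⊤ j≉⊤ j∼y) x≪j
  ...     | inj₁ x≪y = x≪y
  ...     | inj₂ y≪j = contradiction y≪j (SymInterior.lhs≤rhs j∼y)

  -- The argument supplies a summand in which to find ⊤; every other element names its own.
  isOrdinalSum : Index → IsOrdinalSum indexOrder componentHoop A
  isOrdinalSum i₀ = record
    { ι          = λ _ → proj₁
    ; ι-cong     = λ _ x≈y → x≈y
    ; ι-inj      = λ _ x≈y → x≈y
    ; ι-resp     = λ where
        _ (x , inj₁ x≈⊤) → (x , inj₁ x≈⊤) , refl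
        {_ , i≉⊤} (i≲j , j≲i) (x , inj₂ i∼x) →
          (x , inj₂ (∼-trans i≉⊤ (j≲i , i≲j) i∼x)) , refl
    ; ι-surj     = λ b → case em {b ≈ ⊤} of λ where
        (yes b≈⊤) → i₀ , (b , inj₁ b≈⊤) , refl
        (no  b≉⊤) → (b , b≉⊤) , (b , inj₂ ∼-refl) , refl
    ; ι-disjoint = disjoint
    ; ι-⊤        = λ _ → refl
    ; ι-∙        = λ _ _ _ → refl
    ; ι-⇒        = λ _ _ _ → refl
    ; <-∙ˡ       = λ {i} {j} i<j x y x≉⊤ → ≪-∙ (<⇒≪ {i} {j} i<j (proj₂ x) (proj₂ y) x≉⊤)
    ; <-∙ʳ       = λ {i} {j} i<j x y x≉⊤ → trans (comm _ _) (≪-∙ (<⇒≪ {i} {j} i<j (proj₂ x) (proj₂ y) x≉⊤))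
    ; <-⇒        = λ {i} {j} i<j x y x≉⊤ → ≪⇒≤ (<⇒≪ {i} {j} i<j (proj₂ x) (proj₂ y) x≉⊤)
    ; >-⇒        = λ {i} {j} i<j x y → case em {proj₁ y ≈ ⊤} of λ where
        (yes y≈⊤) → trans (⇒-congˡ y≈⊤) (trans (x≤⊤ _) (sym y≈⊤))
        (no  y≉⊤) → proj₁ (<⇒≪ {i} {j} i<j (proj₂ y) (proj₂ x) y≉⊤)
    }
    where
    disjoint : ∀ {i j} → ¬ (i I.≈ j) → (x : ∃ (Component i)) (y : ∃ (Component j)) →
               proj₁ x ≈ proj₁ y → proj₁ x ≈ ⊤
    disjoint i≁j (_ , inj₁ x≈⊤) _ _ = x≈⊤
    disjoint i≁j (_ , inj₂ _) (_ , inj₁ y≈⊤) x≈y = trans x≈y y≈⊤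
    disjoint {_ , i≉⊤} {_ , j≉⊤} i≁j (_ , inj₂ i∼x) (_ , inj₂ j∼y) x≈y =
      contradiction (SymInterior.lhs≤rhs i∼j , SymInterior.rhs≤lhs i∼j) i≁j
      where
      i∼j = ∼-trans (∼⇒≉⊤ i≉⊤ i∼x) i∼x
        (∼-trans (∼⇒≉⊤ j≉⊤ j∼y) (≈⇒∼ x≈y) (∼-sym j∼y))

decompose : ExcludedMiddle ℓ → (C : BoundedHoop ℓ) →
            IsChain (BoundedHoop.hoop C) → Nontrivial (BoundedHoop.hoop C) →
            Decomposition C
decompose em C total (a , b , a≉b) = record
  { index        = indexOrder
  ; 0#           = bottom
  ; 0#-least     = λ i → ≤⇒≲ (⊥-least (proj₁ i))
  ; component    = componentHoop
  ; nontrivial   = λ { i@(x , x≉⊤) → (x , inj₂ ∼-refl) , (⊤ , inj₁ refl) , x≉⊤ }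
  ; total        = λ i x y → total (proj₁ x) (proj₁ y)
  ; wajsberg     = component-wajsberg
  ; least        = (⊥ , inj₂ ∼-refl) , λ x → ⊥-least (proj₁ x)
  ; isOrdinalSum = isOrdinalSum bottom
  }
  where
  open BoundedHoop C
  open HoopProperties hoop
  open ChainProperties em hoop total

  bottom : Index
  -- If ⊥ = ⊤ then every element equals ⊤, against nontriviality.
  bottom = ⊥ , λ ⊥≈⊤ → a≉b
    (trans (⊤-maximum (trans (⇒-congʳ (sym ⊥≈⊤)) (⊥-least a)))
      (sym (⊤-maximum (trans (⇒-congʳ (sym ⊥≈⊤)) (⊥-least b)))))

-- Terms

record _↪_ (A B : Hoop ℓ) : Set ℓ where
  private
    module A = Hoop A
    module B = Hoop B
  field
    ⟦_⟧       : A.Carrier → B.Carrier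
    ⟦⟧-cong   : ∀ {x y} → x A.≈ y → ⟦ x ⟧ B.≈ ⟦ y ⟧
    injective : ∀ {x y} → ⟦ x ⟧ B.≈ ⟦ y ⟧ → x A.≈ y
    ⊤-homo    : ⟦ A.⊤ ⟧ B.≈ B.⊤
    ∙-homo    : ∀ x y → ⟦ x A.∙ y ⟧ B.≈ ⟦ x ⟧ B.∙ ⟦ y ⟧
    ⇒-homo    : ∀ x y → ⟦ x A.⇒ y ⟧ B.≈ (⟦ x ⟧ B.⇒ ⟦ y ⟧)

  evalʰ-homo : ∀ (p : HoopTerm X) ρ → ⟦ evalʰ A p ρ ⟧ B.≈ evalʰ B p (λ v → ⟦ ρ v ⟧)
  evalʰ-homo (var v)  ρ = B.refl
  evalʰ-homo (p ∙ᵗ q) ρ = B.trans (∙-homo _ _) (B.∙-cong (evalʰ-homo p ρ) (evalʰ-homo q ρ))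
  evalʰ-homo (p ⇒ᵗ q) ρ = B.trans (⇒-homo _ _) (B.⇒-cong (evalʰ-homo p ρ) (evalʰ-homo q ρ))
  evalʰ-homo ⊤ᵗ       ρ = ⊤-homo

module _ (A : Hoop ℓ) where
  open Hoop A
  open HoopProperties A

  evalʰ-cong : ∀ (p : HoopTerm X) {ρ σ} → (∀ v → ρ v ≈ σ v) → evalʰ A p ρ ≈ evalʰ A p σ
  evalʰ-cong (var v)  ρ≈σ = ρ≈σ v
  evalʰ-cong (p ∙ᵗ q) ρ≈σ = ∙-cong (evalʰ-cong p ρ≈σ) (evalʰ-cong q ρ≈σ)
  evalʰ-cong (p ⇒ᵗ q) ρ≈σ = ⇒-cong (evalʰ-cong p ρ≈σ) (evalʰ-cong q ρ≈σ)
  evalʰ-cong ⊤ᵗ       ρ≈σ = refl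

  -- The element ⊤ alone forms a subhoop. This will make the idle factor of t₀(¬¬x)·t₁(¬¬x → x)
  -- equal to ⊤.
  evalʰ-⊤ : ∀ (p : HoopTerm X) {ρ} → (∀ v → ρ v ≈ ⊤) → evalʰ A p ρ ≈ ⊤
  evalʰ-⊤ (var v)  ρ≈⊤ = ρ≈⊤ v
  evalʰ-⊤ (p ∙ᵗ q) ρ≈⊤ = trans (∙-cong (evalʰ-⊤ p ρ≈⊤) (evalʰ-⊤ q ρ≈⊤)) (identityˡ ⊤)
  evalʰ-⊤ (p ⇒ᵗ q) ρ≈⊤ = trans (⇒-congˡ (evalʰ-⊤ q ρ≈⊤)) (x≤⊤ _)
  evalʰ-⊤ ⊤ᵗ       ρ≈⊤ = refl

infix 9 _[_]ʰ _[_]ᵇ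

_[_]ʰ : HoopTerm Unit → HoopTerm X → HoopTerm X
var _    [ s ]ʰ = s
(p ∙ᵗ q) [ s ]ʰ = p [ s ]ʰ ∙ᵗ q [ s ]ʰ
(p ⇒ᵗ q) [ s ]ʰ = p [ s ]ʰ ⇒ᵗ q [ s ]ʰ
⊤ᵗ       [ s ]ʰ = ⊤ᵗ

_[_]ᵇ : BoundedTerm Unit → BoundedTerm X → BoundedTerm X
var _    [ s ]ᵇ = s
(p ∙ᵗ q) [ s ]ᵇ = p [ s ]ᵇ ∙ᵗ q [ s ]ᵇ
(p ⇒ᵗ q) [ s ]ᵇ = p [ s ]ᵇ ⇒ᵗ q [ s ]ᵇ
⊤ᵗ       [ s ]ᵇ = ⊤ᵗ
⊥ᵗ       [ s ]ᵇ = ⊥ᵗ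

evalʰ-[] : ∀ (A : Hoop ℓ) p (s : HoopTerm X) ρ →
           evalʰ A (p [ s ]ʰ) ρ ≡ evalʰ A p (λ _ → evalʰ A s ρ)
evalʰ-[] A (var _)  s ρ = ≡.refl
evalʰ-[] A (p ∙ᵗ q) s ρ = cong₂ (Hoop._∙_ A) (evalʰ-[] A p s ρ) (evalʰ-[] A q s ρ)
evalʰ-[] A (p ⇒ᵗ q) s ρ = cong₂ (Hoop._⇒_ A) (evalʰ-[] A p s ρ) (evalʰ-[] A q s ρ)
evalʰ-[] A ⊤ᵗ       s ρ = ≡.refl

module _ (A : BoundedHoop ℓ) where
  open BoundedHoop A

  evalᵇ-cong : ∀ (p : BoundedTerm X) {ρ σ} → (∀ v → ρ v ≈ σ v) → evalᵇ A p ρ ≈ evalᵇ A p σ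
  evalᵇ-cong (var v)  ρ≈σ = ρ≈σ v
  evalᵇ-cong (p ∙ᵗ q) ρ≈σ = ∙-cong (evalᵇ-cong p ρ≈σ) (evalᵇ-cong q ρ≈σ)
  evalᵇ-cong (p ⇒ᵗ q) ρ≈σ = ⇒-cong (evalᵇ-cong p ρ≈σ) (evalᵇ-cong q ρ≈σ)
  evalᵇ-cong ⊤ᵗ       ρ≈σ = refl
  evalᵇ-cong ⊥ᵗ       ρ≈σ = refl

  evalᵇ-[] : ∀ p (s : BoundedTerm X) ρ →
             evalᵇ A (p [ s ]ᵇ) ρ ≡ evalᵇ A p (λ _ → evalᵇ A s ρ)
  evalᵇ-[] (var _)  s ρ = ≡.refl
  evalᵇ-[] (p ∙ᵗ q) s ρ = cong₂ _∙_ (evalᵇ-[] p s ρ) (evalᵇ-[] q s ρ)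
  evalᵇ-[] (p ⇒ᵗ q) s ρ = cong₂ _⇒_ (evalᵇ-[] p s ρ) (evalᵇ-[] q s ρ)
  evalᵇ-[] ⊤ᵗ       s ρ = ≡.refl
  evalᵇ-[] ⊥ᵗ       s ρ = ≡.refl

  evalᵇ-⟨⟩ : ∀ p (s : BoundedTerm X) ρ →
             evalᵇ A (p ⟨ s ⟩) ρ ≡ evalʰ hoop p (λ _ → evalᵇ A s ρ)
  evalᵇ-⟨⟩ (var _)  s ρ = ≡.refl
  evalᵇ-⟨⟩ (p ∙ᵗ q) s ρ = cong₂ _∙_ (evalᵇ-⟨⟩ p s ρ) (evalᵇ-⟨⟩ q s ρ)
  evalᵇ-⟨⟩ (p ⇒ᵗ q) s ρ = cong₂ _⇒_ (evalᵇ-⟨⟩ p s ρ) (evalᵇ-⟨⟩ q s ρ)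
  evalᵇ-⟨⟩ ⊤ᵗ       s ρ = ≡.refl

module _ {A B : BoundedHoop ℓ} (ι : BoundedHoop.hoop A ↪ BoundedHoop.hoop B) where
  private
    module A = BoundedHoop A
    module B = BoundedHoop B
  open _↪_ ι

  evalᵇ-homo : ⟦ A.⊥ ⟧ B.≈ B.⊥ → ∀ (p : BoundedTerm X) ρ →
               ⟦ evalᵇ A p ρ ⟧ B.≈ evalᵇ B p (λ v → ⟦ ρ v ⟧)
  evalᵇ-homo ⊥-homo (var v)  ρ = B.refl
  evalᵇ-homo ⊥-homo (p ∙ᵗ q) ρ = B.trans (∙-homo _ _)
    (B.∙-cong (evalᵇ-homo ⊥-homo p ρ) (evalᵇ-homo ⊥-homo q ρ))
  evalᵇ-homo ⊥-homo (p ⇒ᵗ q) ρ = B.trans (⇒-homo _ _)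
    (B.⇒-cong (evalᵇ-homo ⊥-homo p ρ) (evalᵇ-homo ⊥-homo q ρ))
  evalᵇ-homo ⊥-homo ⊤ᵗ       ρ = ⊤-homo
  evalᵇ-homo ⊥-homo ⊥ᵗ       ρ = ⊥-homo

-- Eliminating ⊥ from terms

infixr 6 _⊕ᵗ_

-- `neg p` stands for the negation of `p`. One outer sign suffices because negation is involutive in
-- a bounded Wajsberg hoop.
data Signed (X : Set) : Set where
  pos neg : HoopTerm X → Signed X

-- In a bounded Wajsberg hoop (x → x·y) → y = ¬x → y.
_⊕ᵗ_ : HoopTerm X → HoopTerm X → HoopTerm X
p ⊕ᵗ q = (p ⇒ᵗ p ∙ᵗ q) ⇒ᵗ q

-- The clauses are p·¬q = ¬(p → q), ¬p·¬q = ¬(¬p → q), p → ¬q = ¬(p·q) and ¬p → ¬q = q → p, with ⊥ =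
-- ¬⊤ and `_⊕ᵗ_` for ¬p → q.
signed : BoundedTerm X → Signed X
signed (var v)  = pos (var v)
signed ⊤ᵗ       = pos ⊤ᵗ
signed ⊥ᵗ       = neg ⊤ᵗ
signed (p ∙ᵗ q) with signed p | signed q
... | pos p′ | pos q′ = pos (p′ ∙ᵗ q′)
... | pos p′ | neg q′ = neg (p′ ⇒ᵗ q′)
... | neg p′ | pos q′ = neg (q′ ⇒ᵗ p′)
... | neg p′ | neg q′ = neg (p′ ⊕ᵗ q′)
signed (p ⇒ᵗ q) with signed p | signed q
... | pos p′ | pos q′ = pos (p′ ⇒ᵗ q′)
... | pos p′ | neg q′ = neg (p′ ∙ᵗ q′)
... | neg p′ | pos q′ = pos (p′ ⊕ᵗ q′)
... | neg p′ | neg q′ = pos (q′ ⇒ᵗ p′)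

-- `nothing` stands for ⊥. The variables range over dense elements, those with ¬x = ⊥; their ⊥-free
-- combinations are dense again, so each such combination has negation ⊥, while ⊥ → y = ⊤.
dense : BoundedTerm X → Maybe (HoopTerm X)
dense (var v)  = just (var v)
dense ⊤ᵗ       = just ⊤ᵗ
dense ⊥ᵗ       = nothing
dense (p ∙ᵗ q) with dense p | dense q
... | just p′ | just q′ = just (p′ ∙ᵗ q′)
... | just _  | nothing = nothing
... | nothing | _       = nothing
dense (p ⇒ᵗ q) with dense p | dense q
... | just p′ | just q′ = just (p′ ⇒ᵗ q′)
... | just _  | nothing = nothing
... | nothing | _       = just ⊤ᵗ

module BoundedProperties (A : BoundedHoop ℓ) where
  open BoundedHoop A
  open HoopProperties hoop
  open import Relation.Binary.Reasoning.Setoid setoid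

  infix 8 ~_
  ~_ : Op₁ Carrier
  ~ x = x ⇒ ⊥

  ⊥-minimum : ∀ {x} → x ≤ ⊥ → x ≈ ⊥
  ⊥-minimum x≤⊥ = ≤-antisym x≤⊥ (⊥-least _)

  ~⊤≈⊥ : ~ ⊤ ≈ ⊥
  ~⊤≈⊥ = ⇒-identityˡ ⊥

  ∙-zeroˡ : ∀ x → ⊥ ∙ x ≈ ⊥
  ∙-zeroˡ x = ⊥-minimum (x∙y≤x ⊥ x)

  ∙-zeroʳ : ∀ x → x ∙ ⊥ ≈ ⊥
  ∙-zeroʳ x = ⊥-minimum (x∙y≤y x ⊥)

  ⟦_⟧ₛ : Signed X → (X → Carrier) → Carrier
  ⟦ pos p ⟧ₛ ρ = evalʰ hoop p ρ
  ⟦ neg p ⟧ₛ ρ = ~ evalʰ hoop p ρ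

  ⟦_⟧ₘ : Maybe (HoopTerm X) → (X → Carrier) → Carrier
  ⟦ just p  ⟧ₘ ρ = evalʰ hoop p ρ
  ⟦ nothing ⟧ₘ ρ = ⊥

  -- Dense elements form a subhoop: ¬(p·q) = p → ¬q reduces to ¬p, and p → q lies above `q`.
  evalʰ-dense : ∀ (p : HoopTerm X) {ρ} → (∀ v → ~ ρ v ≈ ⊥) → ~ evalʰ hoop p ρ ≈ ⊥
  evalʰ-dense (var v)  ~ρ≈⊥ = ~ρ≈⊥ v
  evalʰ-dense (p ∙ᵗ q) ~ρ≈⊥ = trans (sym (currying _ _ _))
    (trans (⇒-congˡ (evalʰ-dense q ~ρ≈⊥)) (evalʰ-dense p ~ρ≈⊥))
  evalʰ-dense (p ⇒ᵗ q) ~ρ≈⊥ = ⊥-minimum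
    (≤-trans (⇒-antiˡ-≤ ⊥ (y≤x⇒y _ _)) (≤-reflexive (evalʰ-dense q ~ρ≈⊥)))
  evalʰ-dense ⊤ᵗ       ~ρ≈⊥ = ~⊤≈⊥

  dense-correct : ∀ (p : BoundedTerm X) {ρ} → (∀ v → ~ ρ v ≈ ⊥) →
                  evalᵇ A p ρ ≈ ⟦ dense p ⟧ₘ ρ
  dense-correct (var v)  _ = refl
  dense-correct ⊤ᵗ       _ = refl
  dense-correct ⊥ᵗ       _ = refl
  dense-correct (p ∙ᵗ q) ~ρ≈⊥ with dense p | dense q | dense-correct p ~ρ≈⊥ | dense-correct q ~ρ≈⊥
  ... | just _  | just _  | p≈ | q≈ = ∙-cong p≈ q≈
  ... | just _  | nothing | _  | q≈ = trans (∙-congˡ q≈) (∙-zeroʳ _)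
  ... | nothing | _       | p≈ | _  = trans (∙-congʳ p≈) (∙-zeroˡ _)
  dense-correct (p ⇒ᵗ q) ~ρ≈⊥ with dense p | dense q | dense-correct p ~ρ≈⊥ | dense-correct q ~ρ≈⊥
  ... | just _  | just _  | p≈ | q≈ = ⇒-cong p≈ q≈
  ... | just p′ | nothing | p≈ | q≈ = trans (⇒-cong p≈ q≈) (evalʰ-dense p′ ~ρ≈⊥)
  ... | nothing | _       | p≈ | _  = trans (⇒-congʳ p≈) (⊥-least _)

  -- ⊤ is itself dense, so the normal form applies at ⊤.
  dense-nothing : ∀ (p : BoundedTerm X) → dense p ≡ nothing → evalᵇ A p (λ _ → ⊤) ≈ ⊥
  dense-nothing p eq = trans (dense-correct p (λ _ → ~⊤≈⊥))
    (reflexive (cong (λ m → ⟦ m ⟧ₘ _) eq))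

  module _ (wajsberg : IsWajsberg hoop) where

    ~-involutive : ∀ x → ~ ~ x ≈ x
    ~-involutive x = begin
      ~ ~ x         ≈⟨ wajsberg x ⊥ ⟩
      (⊥ ⇒ x) ⇒ x   ≈⟨ ⇒-congʳ (⊥-least x) ⟩
      ⊤ ⇒ x         ≈⟨ ⇒-identityˡ x ⟩
      x             ∎

    ∙-~ : ∀ x y → x ∙ ~ y ≈ ~ (x ⇒ y)
    ∙-~ x y = begin
      x ∙ ~ y         ≈⟨ ~-involutive _ ⟨
      ~ ~ (x ∙ ~ y)   ≈⟨ ⇒-congʳ (currying x (~ y) ⊥) ⟨
      ~ (x ⇒ ~ ~ y)   ≈⟨ ⇒-congʳ (⇒-congˡ (~-involutive y)) ⟩
      ~ (x ⇒ y)       ∎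

    ⇒-contrapositive : ∀ x y → ~ x ⇒ ~ y ≈ y ⇒ x
    ⇒-contrapositive x y = trans (exchange (~ x) y ⊥) (⇒-congˡ (~-involutive x))

    -- After padding to ((¬x → y) → y) → y, the Wajsberg law swaps the inner pair; then y → ¬x =
    -- ¬(x·y), and contraposition removes the negations.
    ~⇒ : ∀ x y → ~ x ⇒ y ≈ (x ⇒ x ∙ y) ⇒ y
    ~⇒ x y = begin
      ~ x ⇒ y                 ≈⟨ triple-⇒ (~ x) y ⟨
      ((~ x ⇒ y) ⇒ y) ⇒ y     ≈⟨ ⇒-congʳ (wajsberg (~ x) y) ⟩
      ((y ⇒ ~ x) ⇒ ~ x) ⇒ y   ≈⟨ ⇒-congʳ (⇒-congʳ (trans (exchange y x ⊥) (currying x y ⊥))) ⟩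
      (~ (x ∙ y) ⇒ ~ x) ⇒ y   ≈⟨ ⇒-congʳ (⇒-contrapositive (x ∙ y) x) ⟩
      (x ⇒ x ∙ y) ⇒ y         ∎

    signed-correct : ∀ (p : BoundedTerm X) ρ → evalᵇ A p ρ ≈ ⟦ signed p ⟧ₛ ρ
    signed-correct (var v)  ρ = refl
    signed-correct ⊤ᵗ       ρ = refl
    signed-correct ⊥ᵗ       ρ = sym ~⊤≈⊥
    signed-correct (p ∙ᵗ q) ρ with signed p | signed q | signed-correct p ρ | signed-correct q ρ
    ... | pos _ | pos _ | p≈ | q≈ = ∙-cong p≈ q≈
    ... | pos _ | neg _ | p≈ | q≈ = trans (∙-cong p≈ q≈) (∙-~ _ _)
    ... | neg _ | pos _ | p≈ | q≈ = trans (∙-cong p≈ q≈) (trans (comm _ _) (∙-~ _ _))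
    ... | neg _ | neg _ | p≈ | q≈ =
      trans (∙-cong p≈ q≈) (trans (∙-~ _ _) (⇒-congʳ (~⇒ _ _)))
    signed-correct (p ⇒ᵗ q) ρ with signed p | signed q | signed-correct p ρ | signed-correct q ρ
    ... | pos _ | pos _ | p≈ | q≈ = ⇒-cong p≈ q≈
    ... | pos _ | neg _ | p≈ | q≈ = trans (⇒-cong p≈ q≈) (currying _ _ _)
    ... | neg _ | pos _ | p≈ | q≈ = trans (⇒-cong p≈ q≈) (~⇒ _ _)
    ... | neg _ | neg _ | p≈ | q≈ = trans (⇒-cong p≈ q≈) (⇒-contrapositive _ _)

-- Conuclei as equational notions

infixr 6 _⇒ᵒ_
infixl 7 _∙ᵒ_

-- Hoop terms with an extra unary symbol. Laws in this signature can be tested on any operator, and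
-- become hoop identities once a term replaces `δᵒ`.
data OpTerm : Set where
  var       : ℕ → OpTerm
  _∙ᵒ_ _⇒ᵒ_ : OpTerm → OpTerm → OpTerm
  ⊤ᵒ        : OpTerm
  δᵒ        : OpTerm → OpTerm

module _ (A : Hoop ℓ) (δ : Op₁ (Hoop.Carrier A)) where
  open Hoop A

  evalᵒ : OpTerm → (ℕ → Carrier) → Carrier
  evalᵒ (var v)  ρ = ρ v
  evalᵒ (p ∙ᵒ q) ρ = evalᵒ p ρ ∙ evalᵒ q ρ
  evalᵒ (p ⇒ᵒ q) ρ = evalᵒ p ρ ⇒ evalᵒ q ρ
  evalᵒ ⊤ᵒ       ρ = ⊤
  evalᵒ (δᵒ p)   ρ = δ (evalᵒ p ρ)

  Obeys : Rel OpTerm 0ℓ → Set ℓ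
  Obeys E = ∀ {p q} → E p q → ∀ ρ → evalᵒ p ρ ≈ evalᵒ q ρ

module _ {A B : Hoop ℓ} (ι : A ↪ B) where
  private
    module A = Hoop A
    module B = Hoop B
  open _↪_ ι

  obeys-↪ : ∀ {α β E} → Congruent₁ B._≈_ β → (∀ x → ⟦ α x ⟧ B.≈ β ⟦ x ⟧) →
            Obeys B β E → Obeys A α E
  obeys-↪ {α} {β} β-cong commutes β-obeys {p} {q} law ρ =
      injective (B.trans (evalᵒ-homo p) (B.trans (β-obeys law _) (B.sym (evalᵒ-homo q))))
    where
    evalᵒ-homo : ∀ p → ⟦ evalᵒ A α p ρ ⟧ B.≈ evalᵒ B β p (λ v → ⟦ ρ v ⟧)
    evalᵒ-homo (var v)  = B.refl
    evalᵒ-homo (p ∙ᵒ q) = B.trans (∙-homo _ _) (B.∙-cong (evalᵒ-homo p) (evalᵒ-homo q))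
    evalᵒ-homo (p ⇒ᵒ q) = B.trans (⇒-homo _ _) (B.⇒-cong (evalᵒ-homo p) (evalᵒ-homo q))
    evalᵒ-homo ⊤ᵒ       = ⊤-homo
    evalᵒ-homo (δᵒ p)   = B.trans (commutes _) (β-cong (evalᵒ-homo p))

private
  𝕒 𝕓 : OpTerm
  𝕒 = var 0
  𝕓 = var 1

-- Monotonicity is an identity because b ≤ a iff b = a·(a → b).
data InteriorLaw : Rel OpTerm 0ℓ where
  contractive : InteriorLaw (δᵒ 𝕒 ⇒ᵒ 𝕒) ⊤ᵒ
  monotone    : InteriorLaw (δᵒ (𝕒 ∙ᵒ (𝕒 ⇒ᵒ 𝕓)) ⇒ᵒ δᵒ 𝕒) ⊤ᵒ
  idempotent  : InteriorLaw (δᵒ (δᵒ 𝕒)) (δᵒ 𝕒)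

data ConucleusLaw : Rel OpTerm 0ℓ where
  interior          : ∀ {p q} → InteriorLaw p q → ConucleusLaw p q
  submultiplicative : ConucleusLaw (δᵒ 𝕒 ∙ᵒ δᵒ 𝕓 ⇒ᵒ δᵒ (𝕒 ∙ᵒ 𝕓)) ⊤ᵒ
  unital            : ConucleusLaw (δᵒ 𝕒 ∙ᵒ δᵒ ⊤ᵒ) (δᵒ 𝕒)

data MultiplicativeLaw : Rel OpTerm 0ℓ where
  interior       : ∀ {p q} → InteriorLaw p q → MultiplicativeLaw p q
  multiplicative : MultiplicativeLaw (δᵒ (𝕒 ∙ᵒ 𝕓)) (δᵒ 𝕒 ∙ᵒ δᵒ 𝕓)

module _ {A : Hoop ℓ} {δ : Op₁ (Hoop.Carrier A)} where
  open Hoop A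
  open HoopProperties A

  private
    pair : Carrier → Carrier → ℕ → Carrier
    pair a b zero    = a
    pair a b (suc _) = b

  interior⇔laws : Congruent₁ _≈_ δ → IsInterior A δ ⇔ Obeys A δ InteriorLaw
  interior⇔laws δ-cong = mk⇔ to from
    where
    to : IsInterior A δ → Obeys A δ InteriorLaw
    to δ-int contractive ρ = IsInterior.contractive δ-int _
    to δ-int monotone    ρ = IsInterior.monotone δ-int (x∙y≤x _ _)
    to δ-int idempotent  ρ = IsInterior.idempotent δ-int _

    from : Obeys A δ InteriorLaw → IsInterior A δ
    from obeys = record
      { contractive = λ a → obeys contractive (λ _ → a)
      ; monotone    = λ {a} {b} a≤b → ≤-trans (≤-reflexive (δ-cong (sym (meet a≤b))))
                                              (obeys monotone (pair b a))
      ; idempotent  = λ a → obeys idempotent (λ _ → a)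
      }

  conucleus⇔laws : Congruent₁ _≈_ δ → IsConucleus A δ ⇔ Obeys A δ ConucleusLaw
  conucleus⇔laws δ-cong = mk⇔ to from
    where
    open Equivalence (interior⇔laws δ-cong) renaming (to to toᵢ; from to fromᵢ)

    to : IsConucleus A δ → Obeys A δ ConucleusLaw
    to δ-con (interior law)    ρ = toᵢ (IsConucleus.isInterior δ-con) law ρ
    to δ-con submultiplicative ρ = IsConucleus.submultiplicative δ-con _ _
    to δ-con unital            ρ = IsConucleus.unital δ-con _

    from : Obeys A δ ConucleusLaw → IsConucleus A δ
    from obeys = record
      { isInterior        = fromᵢ (λ law → obeys (interior law))
      ; submultiplicative = λ a b → obeys submultiplicative (pair a b)
      ; unital            = λ a → obeys unital (λ _ → a)
      }

  multiplicative⇔laws : Congruent₁ _≈_ δ →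
                        IsMultiplicativeConucleus A δ ⇔ Obeys A δ MultiplicativeLaw
  multiplicative⇔laws δ-cong = mk⇔ to from
    where
    open Equivalence (interior⇔laws δ-cong) renaming (to to toᵢ; from to fromᵢ)

    to : IsMultiplicativeConucleus A δ → Obeys A δ MultiplicativeLaw
    to δ-mul (interior law) ρ = toᵢ (IsMultiplicativeConucleus.isInterior δ-mul) law ρ
    to δ-mul multiplicative ρ = IsMultiplicativeConucleus.multiplicative δ-mul _ _

    from : Obeys A δ MultiplicativeLaw → IsMultiplicativeConucleus A δ
    from obeys = record
      { isInterior     = fromᵢ (λ law → obeys (interior law))
      ; multiplicative = λ a b → obeys multiplicative (pair a b)
      }

-- Gluing along ordinal sums

-- The pieces need not be all summands: with a setoid of indices it is
-- convenient to keep only one name of the bottom summand.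
record Assembly {I : TotalOrder ℓ ℓ ℓ} {A : TotalOrder.Carrier I → Hoop ℓ} {B : Hoop ℓ}
                (sum : IsOrdinalSum I A B) (δ : Op₁ (Hoop.Carrier B)) : Set (lsuc ℓ) where
  open Hoop B
  open IsOrdinalSum sum using (ι)
  field
    Piece    : TotalOrder.Carrier I → Set ℓ
    cover    : ∀ b → ∃ λ i → Piece i × ∃ λ x → ι i x ≈ b
    local    : ∀ {i} → Piece i → Op₁ (Hoop.Carrier (A i))
    restrict : ∀ {i} (p : Piece i) x → ι i (local p x) ≈ δ (ι i x)
    δ-cong   : Congruent₁ _≈_ δ
    δ-⊤      : δ ⊤ ≈ ⊤

module Gluing (em : ExcludedMiddle ℓ) {I : TotalOrder ℓ ℓ ℓ}
              {A : TotalOrder.Carrier I → Hoop ℓ} {B : Hoop ℓ}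
              {sum : IsOrdinalSum I A B} {δ : Op₁ (Hoop.Carrier B)}
              (assembly : Assembly sum δ) where
  private
    module I = TotalOrder I
    module A i = Hoop (A i)
  open NonStrictToStrict I._≈_ I._≤_ using (_<_)
  open Hoop B
  open HoopProperties B
  open IsOrdinalSum sum
  open Assembly assembly

  _∋_ : I.Carrier → Pred Carrier ℓ
  i ∋ a = ∃ λ x → ι i x ≈ a

  δ-∋ : ∀ {i a} → Piece i → i ∋ a → i ∋ δ a
  δ-∋ p (x , x↦a) = local p x , trans (restrict p x) (δ-cong x↦a)

  data Position (a b : Carrier) : Set ℓ where
    same  : ∀ {i} → Piece i → i ∋ a → i ∋ b → Position a b
    below : ∀ {i j} → Piece i → Piece j → i < j → i ∋ a → j ∋ b → Position a b
    above : ∀ {i j} → Piece i → Piece j → i < j → i ∋ b → j ∋ a → Position a b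

  position : ∀ a b → Position a b
  position a b with cover a | cover b
  ... | i , p , x , x↦a | j , q , j∋b with em {i I.≈ j}
  -- Equal indices may still be different names, so `a` is renamed into the summand of `b`.
  ...   | yes i≈j = let x′ , x↦x′ = ι-resp i≈j x
                    in same q (x′ , trans (sym x↦x′) x↦a) j∋b
  ...   | no i≉j = case I.total i j of λ where
    (inj₁ i≤j) → below p q (i≤j , i≉j) (x , x↦a) j∋b
    (inj₂ j≤i) → above q p (j≤i , λ j≈i → i≉j (I.Eq.sym j≈i)) j∋b (x , x↦a)

  ι-mono : ∀ {i x y} → Hoop._≤_ (A i) x y → ι i x ≤ ι i y
  ι-mono {i} x≤y = trans (sym (ι-⇒ i _ _)) (trans (ι-cong i x≤y) (ι-⊤ i))

  ι-cancel-≤ : ∀ {i x y} → ι i x ≤ ι i y → Hoop._≤_ (A i) x y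
  ι-cancel-≤ {i} ιx≤ιy = ι-inj i (trans (ι-⇒ i _ _) (trans ιx≤ιy (sym (ι-⊤ i))))

  below-∙ : ∀ {i j a b} → i < j → i ∋ a → j ∋ b → ¬ (a ≈ ⊤) → a ∙ b ≈ a
  below-∙ i<j (x , x↦a) (y , y↦b) a≉⊤ = trans (∙-cong (sym x↦a) (sym y↦b))
    (trans (<-∙ˡ i<j x y (λ x↦⊤ → a≉⊤ (trans (sym x↦a) x↦⊤))) x↦a)

  below-≤ : ∀ {i j a b} → i < j → i ∋ a → j ∋ b → ¬ (a ≈ ⊤) → a ≤ b
  below-≤ i<j i∋a j∋b a≉⊤ = ≤-trans (≤-reflexive (sym (below-∙ i<j i∋a j∋b a≉⊤))) (x∙y≤y _ _)

  above-⇒ : ∀ {i j a b} → i < j → i ∋ b → j ∋ a → a ⇒ b ≈ b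
  above-⇒ i<j (y , y↦b) (x , x↦a) =
    trans (⇒-cong (sym x↦a) (sym y↦b)) (trans (>-⇒ i<j x y) y↦b)

  module Interior (local-interior : ∀ {i} (p : Piece i) → IsInterior (A i) (local p)) where
    private
      module Local {i} (p : Piece i) = IsInterior (local-interior p)

    δ-contractive : ∀ a → δ a ≤ a
    δ-contractive a with cover a
    ... | i , p , x , x↦a = begin
      δ a               ≈⟨ proj₂ (δ-∋ p (x , x↦a)) ⟨
      ι i (local p x)   ≤⟨ ι-mono (Local.contractive p x) ⟩
      ι i x             ≈⟨ x↦a ⟩
      a                 ∎
      where
      open ≤-Reasoning ≤-poset

    δ-idempotent : ∀ a → δ (δ a) ≈ δ a
    δ-idempotent a with cover a
    ... | i , p , i∋a = trans (sym (proj₂ (δ-∋ p (δ-∋ p i∋a))))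
      (trans (ι-cong i (Local.idempotent p _)) (proj₂ (δ-∋ p i∋a)))

    δ≉⊤ : ∀ {a} → ¬ (a ≈ ⊤) → ¬ (δ a ≈ ⊤)
    δ≉⊤ a≉⊤ δa≈⊤ = a≉⊤ (⊤-maximum (≤-trans (≤-reflexive (sym δa≈⊤)) (δ-contractive _)))

    -- Within a summand this is local monotonicity. Otherwise `δ` keeps elements in their summands
    -- and, being contractive, sends no other element to ⊤, so the order of the summands decides.
    δ-monotone : ∀ {a b} → a ≤ b → δ a ≤ δ b
    δ-monotone {a} {b} a≤b with position a b | em {a ≈ ⊤}
    ... | same p (x , x↦a) (y , y↦b) | _ = begin
      δ a               ≈⟨ proj₂ (δ-∋ p (x , x↦a)) ⟨
      ι _ (local p x)   ≤⟨ ι-mono (Local.monotone p (ι-cancel-≤ ιx≤ιy)) ⟩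
      ι _ (local p y)   ≈⟨ proj₂ (δ-∋ p (y , y↦b)) ⟩
      δ b               ∎
      where
      open ≤-Reasoning ≤-poset
      ιx≤ιy = ≤-trans (≤-reflexive x↦a) (≤-trans a≤b (≤-reflexive (sym y↦b)))
    ... | below p q i<j i∋a j∋b | yes a≈⊤ =
      ≤-reflexive (δ-cong (trans a≈⊤ (sym (⊤-maximum (≤-trans (≤-reflexive (sym a≈⊤)) a≤b)))))
    ... | below p q i<j i∋a j∋b | no  a≉⊤ =
      below-≤ i<j (δ-∋ p i∋a) (δ-∋ q j∋b) (δ≉⊤ a≉⊤)
    ... | above p q i<j i∋b j∋a | _ =
      ≤-trans (x≤⊤ _) (≤-reflexive (sym (trans (δ-cong b≈⊤) δ-⊤)))
      where
      -- Here a → b = b since `b` lies in the lower summand, while a ≤ b makes it ⊤.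
      b≈⊤ : b ≈ ⊤
      b≈⊤ = trans (sym (above-⇒ i<j i∋b j∋a)) a≤b

    δ-isInterior : IsInterior B δ
    δ-isInterior = record
      { contractive = δ-contractive
      ; monotone    = δ-monotone
      ; idempotent  = δ-idempotent
      }

    -- If a ≠ ⊤, the factor from the higher summand is absorbed on both sides; if a = ⊤, then δ(⊤) =
    -- ⊤ is used.
    below-δ-∙ : ∀ {i j a b} → Piece i → Piece j → i < j → i ∋ a → j ∋ b →
                δ (a ∙ b) ≈ δ a ∙ δ b
    below-δ-∙ {a = a} {b} p q i<j i∋a j∋b with em {a ≈ ⊤}
    ... | yes a≈⊤ = trans (δ-cong (trans (∙-congʳ a≈⊤) (identityˡ b)))
      (sym (trans (∙-congʳ (trans (δ-cong a≈⊤) δ-⊤)) (identityˡ (δ b))))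
    ... | no  a≉⊤ = trans (δ-cong (below-∙ i<j i∋a j∋b a≉⊤))
      (sym (below-∙ i<j (δ-∋ p i∋a) (δ-∋ q j∋b) (δ≉⊤ a≉⊤)))

    above-δ-∙ : ∀ {i j a b} → Piece i → Piece j → i < j → i ∋ b → j ∋ a →
                δ (a ∙ b) ≈ δ a ∙ δ b
    above-δ-∙ p q i<j i∋b j∋a =
      trans (δ-cong (comm _ _)) (trans (below-δ-∙ p q i<j i∋b j∋a) (comm _ _))

  private
    local-∙ : ∀ {i a b} (p : Piece i) ((x , _) : i ∋ a) ((y , _) : i ∋ b) →
              ι i (A._∙_ i (local p x) (local p y)) ≈ δ a ∙ δ b
    local-∙ p i∋a i∋b = trans (ι-∙ _ _ _) (∙-cong (proj₂ (δ-∋ p i∋a)) (proj₂ (δ-∋ p i∋b)))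

    ∙-local : ∀ {i a b} (p : Piece i) ((x , _) : i ∋ a) ((y , _) : i ∋ b) →
              ι i (local p (A._∙_ i x y)) ≈ δ (a ∙ b)
    ∙-local p (x , x↦a) (y , y↦b) =
      trans (restrict p _) (δ-cong (trans (ι-∙ _ x y) (∙-cong x↦a y↦b)))

  δ-isConucleus : (∀ {i} (p : Piece i) → IsConucleus (A i) (local p)) → IsConucleus B δ
  δ-isConucleus local-con = record
    { isInterior        = δ-isInterior
    ; submultiplicative = λ a b → case position a b of λ where
        (same p i∋a i∋b) → ≤-trans (≤-reflexive (sym (local-∙ p i∋a i∋b)))
          (≤-trans (ι-mono (IsConucleus.submultiplicative (local-con p) _ _))
                   (≤-reflexive (∙-local p i∋a i∋b)))
        (below p q i<j i∋a j∋b) → ≤-reflexive (sym (below-δ-∙ p q i<j i∋a j∋b))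
        (above p q i<j i∋b j∋a) → ≤-reflexive (sym (above-δ-∙ p q i<j i∋b j∋a))
    ; unital            = λ a → trans (∙-congˡ δ-⊤) (identityʳ (δ a))
    }
    where
    open Interior (λ p → IsConucleus.isInterior (local-con p))

  δ-isMultiplicativeConucleus :
    (∀ {i} (p : Piece i) → IsMultiplicativeConucleus (A i) (local p)) →
    IsMultiplicativeConucleus B δ
  δ-isMultiplicativeConucleus local-mul = record
    { isInterior     = δ-isInterior
    ; multiplicative = λ a b → case position a b of λ where
        (same p i∋a i∋b) → trans (sym (∙-local p i∋a i∋b))
          (trans (ι-cong _ (IsMultiplicativeConucleus.multiplicative (local-mul p) _ _))
                 (local-∙ p i∋a i∋b))
        (below p q i<j i∋a j∋b) → below-δ-∙ p q i<j i∋a j∋b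
        (above p q i<j i∋b j∋a) → above-δ-∙ p q i<j i∋b j∋a
    }
    where
    open Interior (λ p → IsMultiplicativeConucleus.isInterior (local-mul p))

-- What the argument uses of a notion of conucleus, so that one proof covers both equivalences: it
-- is equational, includes the interior axioms, admits the constant operator ⊥ and passes from
-- summands to ordinal sums.
record Notion (P : ConucleusNotion ℓ) : Set (lsuc ℓ) where
  field
    Law        : Rel OpTerm 0ℓ
    laws       : ∀ {A δ} → Congruent₁ (Hoop._≈_ A) δ → P A δ ⇔ Obeys A δ Law
    isInterior : ∀ {A δ} → P A δ → IsInterior A δ
    constant-⊥ : ∀ C {δ} → (∀ a → BoundedHoop._≈_ C (δ a) (BoundedHoop.⊥ C)) →
                 P (BoundedHoop.hoop C) δ
    glue       : ExcludedMiddle ℓ → ∀ {I A B sum δ} (asm : Assembly {I = I} {A} {B} sum δ) →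
                 (∀ {i} p → P (A i) (Assembly.local asm {i} p)) → P B δ

module _ (C : BoundedHoop ℓ) {δ : Op₁ (BoundedHoop.Carrier C)} where
  open BoundedHoop C
  open HoopProperties hoop
  open BoundedProperties C

  module _ (δ≈⊥ : ∀ a → δ a ≈ ⊥) where

    ⊥-isInterior : IsInterior hoop δ
    ⊥-isInterior = record
      { contractive = λ a → trans (⇒-congʳ (δ≈⊥ a)) (⊥-least a)
      ; monotone    = λ {a} _ → trans (⇒-congʳ (δ≈⊥ a)) (⊥-least _)
      ; idempotent  = λ a → trans (δ≈⊥ _) (sym (δ≈⊥ a))
      }

    ⊥-isConucleus : IsConucleus hoop δ
    ⊥-isConucleus = record
      { isInterior        = ⊥-isInterior
      ; submultiplicative = λ a b →
          trans (⇒-congʳ (trans (∙-congʳ (δ≈⊥ a)) (∙-zeroˡ _))) (⊥-least _)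
      ; unital            = λ a → trans (∙-congʳ (δ≈⊥ a)) (trans (∙-zeroˡ _) (sym (δ≈⊥ a)))
      }

    ⊥-isMultiplicativeConucleus : IsMultiplicativeConucleus hoop δ
    ⊥-isMultiplicativeConucleus = record
      { isInterior     = ⊥-isInterior
      ; multiplicative = λ a b → trans (δ≈⊥ _) (sym (trans (∙-congʳ (δ≈⊥ a)) (∙-zeroˡ _)))
      }

conucleus : Notion {ℓ} IsConucleus
conucleus = record
  { Law        = ConucleusLaw
  ; laws       = conucleus⇔laws
  ; isInterior = IsConucleus.isInterior
  ; constant-⊥ = λ C → ⊥-isConucleus C
  ; glue       = λ em asm → Gluing.δ-isConucleus em asm
  }

multiplicativeConucleus : Notion {ℓ} IsMultiplicativeConucleus
multiplicativeConucleus = record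
  { Law        = MultiplicativeLaw
  ; laws       = multiplicative⇔laws
  ; isInterior = IsMultiplicativeConucleus.isInterior
  ; constant-⊥ = λ C → ⊥-isMultiplicativeConucleus C
  ; glue       = λ em asm → Gluing.δ-isMultiplicativeConucleus em asm
  }

module _ (A : Hoop ℓ) (t : HoopTerm Unit) where

  operatorʰ : Op₁ (Hoop.Carrier A)
  operatorʰ a = evalʰ A t (λ _ → a)

  operatorʰ-cong : Congruent₁ (Hoop._≈_ A) operatorʰ
  operatorʰ-cong a≈b = evalʰ-cong A t (λ _ → a≈b)

module _ (C : BoundedHoop ℓ) (t : BoundedTerm Unit) where

  operatorᵇ : Op₁ (BoundedHoop.Carrier C)
  operatorᵇ a = evalᵇ C t (λ _ → a)

  operatorᵇ-cong : Congruent₁ (BoundedHoop._≈_ C) operatorᵇ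
  operatorᵇ-cong a≈b = evalᵇ-cong C t (λ _ → a≈b)

-- From generators to varieties

module _ (t : HoopTerm Unit) where

  toHoopTerm : OpTerm → HoopTerm ℕ
  toHoopTerm (var v)  = var v
  toHoopTerm (p ∙ᵒ q) = toHoopTerm p ∙ᵗ toHoopTerm q
  toHoopTerm (p ⇒ᵒ q) = toHoopTerm p ⇒ᵗ toHoopTerm q
  toHoopTerm ⊤ᵒ       = ⊤ᵗ
  toHoopTerm (δᵒ p)   = t [ toHoopTerm p ]ʰ

  evalʰ-toHoopTerm : ∀ (A : Hoop ℓ) p ρ →
                     evalʰ A (toHoopTerm p) ρ ≡ evalᵒ A (operatorʰ A t) p ρ
  evalʰ-toHoopTerm A (var v)  ρ = ≡.refl
  evalʰ-toHoopTerm A (p ∙ᵒ q) ρ =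
    cong₂ (Hoop._∙_ A) (evalʰ-toHoopTerm A p ρ) (evalʰ-toHoopTerm A q ρ)
  evalʰ-toHoopTerm A (p ⇒ᵒ q) ρ =
    cong₂ (Hoop._⇒_ A) (evalʰ-toHoopTerm A p ρ) (evalʰ-toHoopTerm A q ρ)
  evalʰ-toHoopTerm A ⊤ᵒ       ρ = ≡.refl
  evalʰ-toHoopTerm A (δᵒ p)   ρ = ≡.trans (evalʰ-[] A t (toHoopTerm p) ρ)
    (cong (operatorʰ A t) (evalʰ-toHoopTerm A p ρ))

module _ (t : BoundedTerm Unit) where

  toBoundedTerm : OpTerm → BoundedTerm ℕ
  toBoundedTerm (var v)  = var v
  toBoundedTerm (p ∙ᵒ q) = toBoundedTerm p ∙ᵗ toBoundedTerm q
  toBoundedTerm (p ⇒ᵒ q) = toBoundedTerm p ⇒ᵗ toBoundedTerm q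
  toBoundedTerm ⊤ᵒ       = ⊤ᵗ
  toBoundedTerm (δᵒ p)   = t [ toBoundedTerm p ]ᵇ

  evalᵇ-toBoundedTerm : ∀ (C : BoundedHoop ℓ) p ρ → evalᵇ C (toBoundedTerm p) ρ ≡
                        evalᵒ (BoundedHoop.hoop C) (operatorᵇ C t) p ρ
  evalᵇ-toBoundedTerm C (var v)  ρ = ≡.refl
  evalᵇ-toBoundedTerm C (p ∙ᵒ q) ρ =
    cong₂ (BoundedHoop._∙_ C) (evalᵇ-toBoundedTerm C p ρ) (evalᵇ-toBoundedTerm C q ρ)
  evalᵇ-toBoundedTerm C (p ⇒ᵒ q) ρ =
    cong₂ (BoundedHoop._⇒_ C) (evalᵇ-toBoundedTerm C p ρ) (evalᵇ-toBoundedTerm C q ρ)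
  evalᵇ-toBoundedTerm C ⊤ᵒ       ρ = ≡.refl
  evalᵇ-toBoundedTerm C (δᵒ p)   ρ = ≡.trans (evalᵇ-[] C t (toBoundedTerm p) ρ)
    (cong (operatorᵇ C t) (evalᵇ-toBoundedTerm C p ρ))

-- Relations on terms serve as sets of identities; this yields the translated laws to which
-- membership in a generated variety is applied.
data Image {Y : Set} (f : X → Y) (R : Rel X 0ℓ) : Rel Y 0ℓ where
  image : ∀ {p q} → R p q → Image f R (f p) (f q)

module _ {P : ConucleusNotion ℓ} (notion : Notion P) where
  open Notion notion

  -- The translated laws form a set of identities true in all generators, hence throughout the
  -- variety.
  holdsʰ-𝕍 : ∀ {𝒦 : Pred (Hoop ℓ) k} t → Holdsʰ P t 𝒦 → Holdsʰ P t (𝕍ʰ 𝒦)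
  holdsʰ-𝕍 {𝒦 = 𝒦} t holds {A} A∈ = from (laws (operatorʰ-cong A t)) λ {p} {q} law ρ →
      subst₂ (Hoop._≈_ A) (evalʰ-toHoopTerm t A p ρ) (evalʰ-toHoopTerm t A q ρ)
        (A∈ (Image (toHoopTerm t) Law) (λ {B} → generators {B}) (image law) ρ)
    where
    open Equivalence
    generators : ∀ {B} → B ∈ 𝒦 → ∀ {p q} → Image (toHoopTerm t) Law p q → Satisfiesʰ B p q
    generators {B} B∈ (image {p} {q} law) ρ = subst₂ (Hoop._≈_ B)
      (≡.sym (evalʰ-toHoopTerm t B p ρ)) (≡.sym (evalʰ-toHoopTerm t B q ρ))
      (to (laws (operatorʰ-cong B t)) (holds {B} B∈) law ρ)

  holdsᵇ-𝕍 : ∀ {𝒦 : Pred (BoundedHoop ℓ) k} t → Holdsᵇ P t 𝒦 → Holdsᵇ P t (𝕍ᵇ 𝒦)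
  holdsᵇ-𝕍 {𝒦 = 𝒦} t holds {C} C∈ = from (laws (operatorᵇ-cong C t)) λ {p} {q} law ρ →
      subst₂ (BoundedHoop._≈_ C) (evalᵇ-toBoundedTerm t C p ρ) (evalᵇ-toBoundedTerm t C q ρ)
        (C∈ (Image (toBoundedTerm t) Law) (λ {B} → generators {B}) (image law) ρ)
    where
    open Equivalence
    generators : ∀ {B} → B ∈ 𝒦 → ∀ {p q} → Image (toBoundedTerm t) Law p q → Satisfiesᵇ B p q
    generators {B} B∈ (image {p} {q} law) ρ = subst₂ (BoundedHoop._≈_ B)
      (≡.sym (evalᵇ-toBoundedTerm t B p ρ)) (≡.sym (evalᵇ-toBoundedTerm t B q ρ))
      (to (laws (operatorᵇ-cong B t)) (holds {B} B∈) law ρ)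

-- Generated varieties are tested on identities over `ℕ`, so the single variable is renamed to
-- `var 0`.
⊨-𝕍 : ∀ {𝒦 : Pred (BoundedHoop ℓ) k} (p q : BoundedTerm Unit) →
      𝒦 ⊨ p ≈ q → 𝕍ᵇ 𝒦 ⊨ p ≈ q
⊨-𝕍 p q holds {C} C∈ ρ = subst₂ (BoundedHoop._≈_ C)
  (evalᵇ-[] C p (var 0) _) (evalᵇ-[] C q (var 0) _)
  (C∈ (Image (_[ var 0 ]ᵇ) (λ p′ q′ → p′ ≡ p × q′ ≡ q))
      (λ { {B} B∈ (image (≡.refl , ≡.refl)) σ → subst₂ (BoundedHoop._≈_ B)
             (≡.sym (evalᵇ-[] B p (var 0) σ)) (≡.sym (evalᵇ-[] B q (var 0) σ))
             (holds {B} B∈ (λ _ → σ 0)) })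
      (image (≡.refl , ≡.refl))
      (λ _ → ρ _))

𝒦⊆𝕍ᵇ : ∀ {𝒦 : Pred (BoundedHoop ℓ) k} → 𝒦 ⊆ 𝕍ᵇ 𝒦
𝒦⊆𝕍ᵇ C∈ E 𝒦⊨E = 𝒦⊨E C∈

𝒦⊆𝕍ʰ : ∀ {𝒦 : Pred (Hoop ℓ) k} → 𝒦 ⊆ 𝕍ʰ 𝒦
𝒦⊆𝕍ʰ A∈ E 𝒦⊨E = 𝒦⊨E A∈

-- Terms on ordinal sums

combine : HoopTerm Unit → HoopTerm Unit → BoundedTerm Unit
combine t₀ t₁ = t₀ ⟨ ¬ᵗ ¬ᵗ 𝕩 ⟩ ∙ᵗ t₁ ⟨ ¬ᵗ ¬ᵗ 𝕩 ⇒ᵗ 𝕩 ⟩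

module Decomposed (em : ExcludedMiddle ℓ) {C : BoundedHoop ℓ} (D : Decomposition C) where
  open BoundedHoop C
  open HoopProperties hoop
  open BoundedProperties C
  open Decomposition D hiding (total)
  open IsOrdinalSum isOrdinalSum

  embed : ∀ i → component i ↪ hoop
  embed i = record
    { ⟦_⟧       = ι i
    ; ⟦⟧-cong   = ι-cong i
    ; injective = ι-inj i
    ; ⊤-homo    = ι-⊤ i
    ; ∙-homo    = ι-∙ i
    ; ⇒-homo    = ι-⇒ i
    }

  A₀ : BoundedHoop ℓ
  A₀ = record { hoop = component 0# ; ⊥ = proj₁ least ; ⊥-least = proj₂ least }

  private
    module A₀ = BoundedHoop A₀

  0#-< : ∀ {j} → ¬ (j I.≈ 0#) → 0# I.≤ j × ¬ (0# I.≈ j)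
  0#-< j≉0 = 0#-least _ , λ 0≈j → j≉0 (I.Eq.sym 0≈j)

  -- Some summand contains ⊥. If it is the bottom one, leastness in `A₀` suffices; if it is higher,
  -- every bottom element other than ⊤ lies below it.
  ι-⊥ : ι 0# A₀.⊥ ≈ ⊥
  ι-⊥ with ι-surj ⊥
  ... | j , y , y↦⊥ with em {j I.≈ 0#}
  ...   | yes j≈0 = let y′ , y↦y′ = ι-resp j≈0 y in ⊥-minimum
    (≤-trans (trans (sym (ι-⇒ 0# _ y′)) (trans (ι-cong 0# (A₀.⊥-least y′)) (ι-⊤ 0#)))
             (≤-reflexive (trans (sym y↦y′) y↦⊥)))
  ...   | no  j≉0 = ⊥-minimum
    (≤-trans (<-⇒ (0#-< j≉0) A₀.⊥ y ι⊥≉⊤) (≤-reflexive y↦⊥))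
    where
    -- Were the least element equal to ⊤, the nontrivial bottom component would collapse.
    ι⊥≉⊤ : ¬ (ι 0# A₀.⊥ ≈ ⊤)
    ι⊥≉⊤ ι⊥≈⊤ = let x , y , x≉y = nontrivial 0# in
        x≉y (A₀.trans (collapse x) (A₀.sym (collapse y)))
      where
      open HoopProperties A₀.hoop using () renaming (⇒-congʳ to ⇒₀-congʳ; ⊤-maximum to ⊤₀-maximum)
      collapse : ∀ x → x A₀.≈ A₀.⊤
      collapse x = ⊤₀-maximum (A₀.trans
        (⇒₀-congʳ (A₀.sym (ι-inj 0# (trans ι⊥≈⊤ (sym (ι-⊤ 0#)))))) (A₀.⊥-least x))

  eval-bottom : ∀ t x → ι 0# (operatorᵇ A₀ t x) ≈ operatorᵇ C t (ι 0# x)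
  eval-bottom t x = evalᵇ-homo {A = A₀} {C} (embed 0#) ι-⊥ t (λ _ → x)

  evalʰ-ι : ∀ i t x → ι i (operatorʰ (component i) t x) ≈ operatorʰ hoop t (ι i x)
  evalʰ-ι i t x = _↪_.evalʰ-homo (embed i) t (λ _ → x)

  -- Negation is computed inside `A₀`, where the Wajsberg law makes it involutive.
  bottom-regular : ∀ x → ~ ~ ι 0# x ≈ ι 0# x
  bottom-regular x = trans (sym (eval-bottom (¬ᵗ ¬ᵗ 𝕩) x))
    (ι-cong 0# (BoundedProperties.~-involutive A₀ (wajsberg 0#) x))

  -- ⊥ lies in the bottom summand, and residuation from a higher summand fixes it.
  upper-dense : ∀ {j} → ¬ (j I.≈ 0#) → ∀ x → ~ ι j x ≈ ⊥
  upper-dense j≉0 x =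
    trans (⇒-congˡ (sym ι-⊥)) (trans (>-⇒ (0#-< j≉0) x A₀.⊥) ι-⊥)

  data Piece : I.Carrier → Set ℓ where
    bottom : Piece 0#
    upper  : ∀ {j} → ¬ (j I.≈ 0#) → Piece j

  cover : ∀ b → ∃ λ i → Piece i × ∃ λ x → ι i x ≈ b
  cover b with ι-surj b
  ... | j , x , x↦b with em {j I.≈ 0#}
  ...   | yes j≈0 = let x′ , x↦x′ = ι-resp j≈0 x in
                    0# , bottom , x′ , trans (sym x↦x′) x↦b
  ...   | no  j≉0 = j , upper j≉0 , x , x↦b

  module _ (t₀ t₁ : HoopTerm Unit) where

    pieceTerm : ∀ {i} → Piece i → HoopTerm Unit
    pieceTerm bottom    = t₀
    pieceTerm (upper _) = t₁

    private
      combine-eval : ∀ {b u v} → ~ ~ b ≈ u → u ⇒ b ≈ v →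
                     operatorᵇ C (combine t₀ t₁) b ≈ operatorʰ hoop t₀ u ∙ operatorʰ hoop t₁ v
      combine-eval ~~b≈u u⇒b≈v = ∙-cong
        (trans (reflexive (evalᵇ-⟨⟩ C t₀ _ _)) (operatorʰ-cong hoop t₀ ~~b≈u))
        (trans (reflexive (evalᵇ-⟨⟩ C t₁ _ _))
               (operatorʰ-cong hoop t₁ (trans (⇒-congʳ ~~b≈u) u⇒b≈v)))

    -- The idle factor is evaluated at ⊤: ¬¬x → x = ⊤ on the bottom piece, and ¬¬x = ⊤ on the upper
    -- ones.
    combine-piece : ∀ {i} (p : Piece i) x →
                    operatorʰ hoop (pieceTerm p) (ι i x) ≈ operatorᵇ C (combine t₀ t₁) (ι i x)
    combine-piece bottom x = sym (trans (combine-eval (bottom-regular x) (⇒-refl _))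
      (trans (∙-congˡ (evalʰ-⊤ hoop t₁ (λ _ → refl))) (identityʳ _)))
    combine-piece (upper j≉0) x = sym (trans
      (combine-eval (trans (⇒-congʳ (upper-dense j≉0 x)) (⊥-least ⊥)) (⇒-identityˡ _))
      (trans (∙-congʳ (evalʰ-⊤ hoop t₀ (λ _ → refl))) (identityˡ _)))

    assembly : ∀ t → Satisfiesᵇ C t (combine t₀ t₁) → Assembly isOrdinalSum (operatorᵇ C t)
    assembly t t≈ = record
      { Piece    = Piece
      ; cover    = cover
      ; local    = λ {i} p → operatorʰ (component i) (pieceTerm p)
      ; restrict = restrict
      ; δ-cong   = operatorᵇ-cong C t
      -- ⊤ is taken in the bottom summand, where t₀(⊤) = ⊤.
      ; δ-⊤      = trans (operatorᵇ-cong C t (sym (ι-⊤ 0#)))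
          (trans (sym (restrict bottom A₀.⊤))
          (trans (ι-cong 0# (evalʰ-⊤ A₀.hoop t₀ (λ _ → A₀.refl))) (ι-⊤ 0#)))
      }
      where
      restrict : ∀ {i} (p : Piece i) x →
                 ι i (operatorʰ (component i) (pieceTerm p) x) ≈ operatorᵇ C t (ι i x)
      restrict {i} p x = trans (evalʰ-ι i (pieceTerm p) x)
        (trans (combine-piece p x) (sym (t≈ _)))

  signed-bottom : ∀ t x → ι 0# (BoundedProperties.⟦_⟧ₛ A₀ (signed t) (λ _ → x)) ≈
                          operatorᵇ C t (ι 0# x)
  signed-bottom t x = trans
    (ι-cong 0# (A₀.sym (BoundedProperties.signed-correct A₀ (wajsberg 0#) t (λ _ → x))))
    (eval-bottom t x)

  dense-upper : ∀ {j} → ¬ (j I.≈ 0#) → ∀ t x → ⟦ dense t ⟧ₘ (λ _ → ι j x) ≈ operatorᵇ C t (ι j x)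
  dense-upper j≉0 t x = sym (dense-correct t (λ _ → upper-dense j≉0 x))

  -- In the bottom summand t(⊤) = ¬p(⊤) = ¬⊤.
  signed-neg : ∀ t {p} → signed t ≡ neg p → operatorᵇ C t ⊤ ≈ ⊥
  signed-neg t {p} eq = begin
    operatorᵇ C t ⊤                         ≈⟨ operatorᵇ-cong C t (ι-⊤ 0#) ⟨
    operatorᵇ C t (ι 0# A₀.⊤)               ≈⟨ signed-bottom t A₀.⊤ ⟨
    ι 0# (⟦ signed t ⟧₀ (λ _ → A₀.⊤))       ≡⟨ cong (λ s → ι 0# (⟦ s ⟧₀ (λ _ → A₀.⊤))) eq ⟩
    ι 0# (operatorʰ A₀.hoop p A₀.⊤ A₀.⇒ A₀.⊥)
      ≈⟨ ι-cong 0# (A₀.⇒-cong (evalʰ-⊤ A₀.hoop p (λ _ → A₀.refl)) A₀.refl) ⟩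
    ι 0# (A₀.⊤ A₀.⇒ A₀.⊥)                   ≈⟨ ι-cong 0# (BoundedProperties.~⊤≈⊥ A₀) ⟩
    ι 0# A₀.⊥                               ≈⟨ ι-⊥ ⟩
    ⊥                                       ∎
    where
    open import Relation.Binary.Reasoning.Setoid setoid
    open BoundedProperties A₀ using () renaming (⟦_⟧ₛ to ⟦_⟧₀)

-- The equivalence for an abstract notion of conucleus.

module Characterisation
  {P : ConucleusNotion ℓ} (notion : Notion P) (em : ExcludedMiddle ℓ)
  (𝒦 : Pred (BoundedHoop ℓ) k)
  (chains : ∀ {C} → C ∈ 𝒦 → IsBLChain C × Nontrivial (BoundedHoop.hoop C))
  (t : BoundedTerm Unit) where

  open Notion notion
  open Equivalence

  Splits : HoopTerm Unit → HoopTerm Unit → Set _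
  Splits t₀ t₁ = (𝕍ᵇ 𝒦 ⊨ t ≈ combine t₀ t₁)
               × Holdsʰ P t₀ (𝕍ʰ (FirstComponents 𝒦))
               × Holdsʰ P t₁ (𝕍ʰ (UpperComponents 𝒦))

  decomposition : ∀ {C} → C ∈ 𝒦 → Decomposition C
  decomposition {C} C∈ =
    let isChain , nontrivial = chains C∈ in decompose em C (IsBLChain.total isChain) nontrivial

  -- Monotonicity gives t(a) ≤ t(⊤) = ⊥.
  ⊥-at-⊤⇒⊥ : Holdsᵇ P t 𝒦 → (∀ {C} → C ∈ 𝒦 → BoundedHoop._≈_ C (operatorᵇ C t (BoundedHoop.⊤ C)) (BoundedHoop.⊥ C)) →
              𝒦 ⊨ t ≈ ⊥ᵗ
  ⊥-at-⊤⇒⊥ holds t⊤≈⊥ {C} C∈ ρ = ⊥-minimum (≤-trans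
      (IsInterior.monotone (isInterior (holds C∈)) (x≤⊤ (ρ _)))
      (≤-reflexive (t⊤≈⊥ C∈)))
    where
    open BoundedHoop C
    open HoopProperties hoop
    open BoundedProperties C

  module _ {t₀ t₁ : HoopTerm Unit} (signed≡ : signed t ≡ pos t₀) (dense≡ : dense t ≡ just t₁) where

    module _ {C : BoundedHoop ℓ} (D : Decomposition C) where
      open BoundedHoop C
      open Decomposition D hiding (total)
      open IsOrdinalSum isOrdinalSum
      open Decomposed em D

      -- The decomposition is arbitrary because the generators of the two component varieties come
      -- from all decompositions of members of `𝒦`.
      restrict : ∀ {i} (p : Piece i) x →
        ι i (operatorʰ (component i) (pieceTerm t₀ t₁ p) x) ≈ operatorᵇ C t (ι i x)
      restrict bottom x = trans
        (reflexive (cong (λ s → ι 0# (BoundedProperties.⟦_⟧ₛ A₀ s (λ _ → x))) (≡.sym signed≡)))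
        (signed-bottom t x)
      restrict {j} (upper j≉0) x = trans (evalʰ-ι j t₁ x) (trans
        (reflexive (cong (λ m → BoundedProperties.⟦_⟧ₘ C m (λ _ → ι j x)) (≡.sym dense≡)))
        (dense-upper j≉0 t x))

      -- The notion is equational and, by `restrict`, the embedding of a component carries its local
      -- term to `t`, so the laws are inherited.
      holds-piece : P hoop (operatorᵇ C t) → ∀ {i} (p : Piece i) →
                    P (component i) (operatorʰ (component i) (pieceTerm t₀ t₁ p))
      holds-piece P-t {i} p = from (laws (operatorʰ-cong (component i) (pieceTerm t₀ t₁ p)))
        λ {l} {r} → obeys-↪ (embed i) (operatorᵇ-cong C t) (restrict p)
          (λ {l} {r} → to (laws (operatorᵇ-cong C t)) P-t {l} {r}) {l} {r}

      satisfies-combine : Satisfiesᵇ C t (combine t₀ t₁)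
      satisfies-combine ρ with cover (ρ _)
      ... | i , p , x , x↦b = begin
        operatorᵇ C t (ρ _)         ≈⟨ operatorᵇ-cong C t x↦b ⟨
        operatorᵇ C t (ι i x)       ≈⟨ restrict p x ⟨
        ι i (operatorʰ (component i) (pieceTerm t₀ t₁ p) x)
                                    ≈⟨ evalʰ-ι i (pieceTerm t₀ t₁ p) x ⟩
        operatorʰ hoop (pieceTerm t₀ t₁ p) (ι i x)
                                    ≈⟨ combine-piece t₀ t₁ p x ⟩
        operatorᵇ C (combine t₀ t₁) (ι i x)
                                    ≈⟨ operatorᵇ-cong C (combine t₀ t₁) x↦b ⟩
        operatorᵇ C (combine t₀ t₁) (ρ _) ∎
        where
        open import Relation.Binary.Reasoning.Setoid setoid

    splits : Holdsᵇ P t 𝒦 → Splits t₀ t₁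
    splits holds =
        (λ {A} → ⊨-𝕍 t (combine t₀ t₁)
          (λ C∈ → satisfies-combine (decomposition C∈)) {A})
      , holdsʰ-𝕍 notion t₀ (λ { (first C∈ D) → holds-piece D (holds C∈) bottom })
      , holdsʰ-𝕍 notion t₁ (λ where
          (upper C∈ D j j≉0) → holds-piece D (holds C∈) (upper j≉0)
          trivial            → from (laws (operatorʰ-cong S₀ t₁)) (λ _ _ → _))
      where
      open Decomposed using (bottom; upper)

  -- The two normal forms decide the alternative: unless both are ⊥-free terms, t(⊤) = ⊥ in every
  -- chain of `𝒦`.
  forward : Holdsᵇ P t 𝒦 → (𝕍ᵇ 𝒦 ⊨ t ≈ ⊥ᵗ) ⊎ ∃₂ Splits
  forward holds with signed t in signed≡ | dense t in dense≡
  ... | pos t₀ | just t₁ = inj₂ (t₀ , t₁ , splits signed≡ dense≡ holds)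
  ... | pos _  | nothing = inj₁ (λ {A} → ⊨-𝕍 t ⊥ᵗ (λ {C} → ⊥-at-⊤⇒⊥ holds
    (λ {C} _ → BoundedProperties.dense-nothing C t dense≡) {C}) {A})
  ... | neg _  | _       = inj₁ (λ {A} → ⊨-𝕍 t ⊥ᵗ (λ {C} → ⊥-at-⊤⇒⊥ holds
    (λ C∈ → Decomposed.signed-neg em (decomposition C∈) t signed≡) {C}) {A})

  -- In the second case gluing establishes the notion on each generating chain, and its laws then
  -- extend to the variety.
  backward : (𝕍ᵇ 𝒦 ⊨ t ≈ ⊥ᵗ) ⊎ ∃₂ Splits → Holdsᵇ P t (𝕍ᵇ 𝒦)
  backward (inj₁ t≈⊥) {C} C∈ = constant-⊥ C (λ a → t≈⊥ {C} C∈ (λ _ → a))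
  backward (inj₂ (t₀ , t₁ , t≈ , holds₀ , holds₁)) = holdsᵇ-𝕍 notion t λ {C} C∈ →
    let D = decomposition C∈
        open Decomposed em D
        holds-local : ∀ {i} (p : Piece i) → P (Decomposition.component D i)
                        (operatorʰ (Decomposition.component D i) (pieceTerm t₀ t₁ p))
        holds-local = λ where
          bottom          → holds₀ (𝒦⊆𝕍ʰ (first C∈ D))
          (upper {j} j≉0) → holds₁ (𝒦⊆𝕍ʰ (upper C∈ D j j≉0))
    in glue em (assembly t₀ t₁ t (t≈ {C} (𝒦⊆𝕍ᵇ C∈))) holds-local

  characterisation : Holdsᵇ P t (𝕍ᵇ 𝒦) ⇔ ((𝕍ᵇ 𝒦 ⊨ t ≈ ⊥ᵗ) ⊎ ∃₂ Splits)
  characterisation = mk⇔ (λ holds → forward (λ C∈ → holds (𝒦⊆𝕍ᵇ C∈))) backward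

theorem6p4 : ∀ {ℓ k : Level} → ExcludedMiddle ℓ →
    (K : Pred (BoundedHoop ℓ) k) →
    ∃ K →
    (∀ {C} → C ∈ K → IsBLChain C × Nontrivial (BoundedHoop.hoop C)) →
    (t : BoundedTerm Unit) →
    ( Holdsᵇ IsConucleus t (𝕍ᵇ K)
    ⇔
    ( (𝕍ᵇ K ⊨ t ≈ ⊥ᵗ)
    ⊎ (∃₂ λ (t₀ t₁ : HoopTerm Unit) →
    (𝕍ᵇ K ⊨ t ≈ t₀ ⟨ ¬ᵗ ¬ᵗ 𝕩 ⟩ ∙ᵗ t₁ ⟨ ¬ᵗ ¬ᵗ 𝕩 ⇒ᵗ 𝕩 ⟩)
    × Holdsʰ IsConucleus t₀ (𝕍ʰ (FirstComponents K))
    × Holdsʰ IsConucleus t₁ (𝕍ʰ (UpperComponents K)))))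
    ×
    ( Holdsᵇ IsMultiplicativeConucleus t (𝕍ᵇ K)
    ⇔
    ( (𝕍ᵇ K ⊨ t ≈ ⊥ᵗ)
    ⊎ (∃₂ λ (t₀ t₁ : HoopTerm Unit) →
    (𝕍ᵇ K ⊨ t ≈ t₀ ⟨ ¬ᵗ ¬ᵗ 𝕩 ⟩ ∙ᵗ t₁ ⟨ ¬ᵗ ¬ᵗ 𝕩 ⇒ᵗ 𝕩 ⟩)
    × Holdsʰ IsMultiplicativeConucleus t₀ (𝕍ʰ (FirstComponents K))
    × Holdsʰ IsMultiplicativeConucleus t₁ (𝕍ʰ (UpperComponents K)))))
theorem6p4 em K _ chains t =
    Characterisation.characterisation conucleus em K chains t
  , Characterisation.characterisation multiplicativeConucleus em K chains t
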